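{- Let $q$ be a prime power with $q\equiv 3\pmod 4$, let $G=S_{q^2}$ be the symmetric group on the $q^2$ vectors of $\mathbb{F}_q^2$, and let $H=\mathrm{AGL}_2(q)<G$ in its natural action on $\mathbb{F}_q^2$. Then $H$ is a perfect code of $G$.
   Context: All groups are finite. A perfect code in a simple undirected graph with vertex set $V$ is an independent subset $C\subseteq V$ such that every vertex in $V\setminus C$ is adjacent to exactly one vertex of $C$. For a group $G$ with identity $e$ and an inverse-closed $S\subseteq G\setminus\{e\}$, the Cayley graph $\mathrm{Cay}(G,S)$ has vertex set $G$ and edges $\{g,sg\}$ ($s\in S$, $g\in G$). A subset $C$ of $G$ is a perfect code of $G$ if it is a perfect code in some Cayley graph $\mathrm{Cay}(G,S)$. -}

module Defs where

open import Level using (0ℓ)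
open import Data.Nat using (ℕ; suc; _^_)
open import Data.Nat.Primality using (Prime)
open import Data.Fin using (Fin)
open import Data.Product using (_×_; _,_; Σ; ∃; ∃-syntax; proj₁; proj₂)
open import Relation.Binary.PropositionalEquality using (_≡_; _≢_)
open import Relation.Nullary using (¬_)
open import Algebra.Structures using (IsCommutativeRing)

IsPrimePower : ℕ → Set
IsPrimePower q = ∃[ p ] ∃[ k ] (Prime p × q ≡ p ^ suc k)

-- A finite field of order q, with carrier Fin q (every field of order q
-- is isomorphic to one of this form) and propositional equality.

record FiniteField (q : ℕ) : Set where
  field
    _+_ _*_ : Fin q → Fin q → Fin q
    -_      : Fin q → Fin q
    0# 1#   : Fin q
    isCommutativeRing : IsCommutativeRing _≡_ _+_ _*_ -_ 0# 1#
    0≢1     : 0# ≢ 1#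
    inverse : ∀ x → x ≢ 0# → ∃[ y ] (x * y ≡ 1#)

record Perm (V : Set) : Set where
  field
    to     : V → V
    from   : V → V
    to∘from : ∀ v → to (from v) ≡ v
    from∘to : ∀ v → from (to v) ≡ v
open Perm public

module _ {V : Set} where

  _≈ₚ_ : Perm V → Perm V → Set
  σ ≈ₚ τ = ∀ v → to σ v ≡ to τ v

  idₚ : Perm V
  idₚ = record { to = λ v → v ; from = λ v → v
               ; to∘from = λ _ → _≡_.refl ; from∘to = λ _ → _≡_.refl }

  _·_ : Perm V → Perm V → Perm V
  σ · τ = record
    { to = λ v → to σ (to τ v)
    ; from = λ v → from τ (from σ v)
    ; to∘from = λ v → Relation.Binary.PropositionalEquality.trans
        (Relation.Binary.PropositionalEquality.cong (to σ) (to∘from τ (from σ v)))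
        (to∘from σ v)
    ; from∘to = λ v → Relation.Binary.PropositionalEquality.trans
        (Relation.Binary.PropositionalEquality.cong (from τ) (from∘to σ (to τ v)))
        (from∘to τ v)
    }
    where import Relation.Binary.PropositionalEquality

  _⁻¹ₚ : Perm V → Perm V
  σ ⁻¹ₚ = record { to = from σ ; from = to σ
                 ; to∘from = from∘to σ ; from∘to = to∘from σ }

  -- subsets of the group: predicates closed under group equality
  RespectsEq : (Perm V → Set) → Set
  RespectsEq P = ∀ {σ τ} → σ ≈ₚ τ → P σ → P τ

  IsConnectionSet : (Perm V → Set) → Set
  IsConnectionSet S =
    RespectsEq S × (∀ s → S s → ¬ (s ≈ₚ idₚ)) × (∀ s → S s → S (s ⁻¹ₚ))

  Adj : (Perm V → Set) → Perm V → Perm V → Set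
  Adj S g h = ∃[ s ] (S s × h ≈ₚ (s · g))

  IsPerfectCodeIn : (Perm V → Set) → (Perm V → Set) → Set
  IsPerfectCodeIn S C =
    (∀ c c' → C c → C c' → ¬ Adj S c c')
    × (∀ g → ¬ C g →
         (∃[ c ] (C c × Adj S g c))
         × (∀ c c' → C c → C c' → Adj S g c → Adj S g c' → c ≈ₚ c'))

  IsPerfectCodeOfGroup : (Perm V → Set) → Set₁
  IsPerfectCodeOfGroup C =
    ∃[ S ] (IsConnectionSet S × IsPerfectCodeIn S C)

module _ {q : ℕ} (F : FiniteField q) where
  open FiniteField F

  Vec2 : Set
  Vec2 = Fin q × Fin q

  IsAGL2 : Perm Vec2 → Set
  IsAGL2 σ =
    ∃[ a ] ∃[ b ] ∃[ c ] ∃[ d ] ∃[ u₁ ] ∃[ u₂ ]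
      ((((a * d) + (- (b * c))) ≢ 0#)
      × (∀ x y → to σ (x , y) ≡ (((a * x) + (b * y)) + u₁ , ((c * x) + (d * y)) + u₂)))

{-# OPTIONS --safe #-}
module Submission where

open import Defs
open import Algebra.Bundles using (CommutativeRing; Group)
import Algebra.Properties.Group as GroupProperties
import Algebra.Properties.Ring as RingProperties
import Algebra.Solver.Ring.NaturalCoefficients.Default as Solver
open import Algebra.Structures using (IsGroup)
open import Data.Empty using (⊥; ⊥-elim)
open import Data.Fin.Base
  using (Fin; zero; suc; toℕ; fromℕ<; _<_; _≤_; combine; remQuot; splitAt; join; finToFun; funToFin)
open import Data.Fin.Properties as Fin using (toℕ-injective; any?; all?; _≟_; _≤?_)
open import Data.Nat using (ℕ; _%_)
open import Data.Nat.Base as ℕ using (zero; suc; _^_; _/_; s≤s; z≤n)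
open import Data.Nat.DivMod using (m≡m%n+[m/n]*n)
open import Data.Nat.Divisibility
  using (_∣_; divides; _∣?_; ∣-trans; ∣m∣n⇒∣m+n; ∣m+n∣m⇒∣n; ∣n⇒∣m*n; *-monoˡ-∣; *-cancelʳ-∣)
open import Data.Nat.Primality using (euclidsLemma; prime[2])
import Data.Nat.Properties as ℕ
open import Data.Product.Base using (∃; ∃-syntax; _×_; _,_; proj₁; proj₂)
open import Data.Product.Properties using (≡-dec)
open import Data.Sum.Base as Sum using (_⊎_; inj₁; inj₂; [_,_]′)
open import Data.Unit.Base using (⊤; tt)
open import Function.Base using (_∘_; id)
open import Relation.Binary.Definitions as Binary using (tri<; tri≈; tri>)
open import Relation.Binary.PropositionalEquality
open import Relation.Binary.Structures using (IsEquivalence)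
open import Relation.Nullary using (¬_; Dec; yes; no; ¬?; _×-dec_; _→-dec_)
open import Relation.Nullary.Decidable using (from-no)
open import Relation.Unary using (Decidable)

-- Write H = AGL₂(q). A right and a left coset of H meet whenever they lie in the same double coset, so
-- H is a perfect code as soon as every inverse-closed double coset HcH that consists of an odd number of
-- right cosets contains an element t with t² = 1: pair the right cosets of HcH with those of Hc⁻¹H and
-- connect paired cosets by an element and its inverse, using t for a coset paired with itself.
--
-- Such a t is found in D ∩ B, where D = HcH and B is the stabilizer of the points 0 and e₁. As H is
-- 2-transitive, |D ∩ B| is the odd number of cosets times |H ∩ B| = q (q − 1), hence 2 modulo 4. Let
-- r = diag(1 , −1) ∈ H ∩ B. The four-group generated by x ↦ r x and x ↦ x r acts freely on the elements of
-- D ∩ B not commuting with r. On those commuting with r, the four-group generated by x ↦ r x and x ↦ x⁻¹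
-- acts freely unless some x² is 1 or r, so such an x exists. But r is not a square: a square root would
-- act with cycles of length 4 only on the q (q − 1) points moved by r.

-- Counting the elements of a predicate.

record Enumeration {A : Set} (P : A → Set) (n : ℕ) : Set where
  field
    elem           : Fin n → A
    elem-∈         : ∀ i → P (elem i)
    elem-injective : ∀ {i j} → elem i ≡ elem j → i ≡ j
    -- Proofs of `P a` may differ, but `elem-index` and `elem-injective` make the index depend on
    -- `a` alone, so `n` counts elements and not proofs.
    index          : ∀ {a} → P a → Fin n
    elem-index     : ∀ {a} (p : P a) → elem (index p) ≡ a

open Enumeration

module _ {A B : Set} {P : A → Set} {Q : B → Set} where

  size-≤ : ∀ {m n} → Enumeration P m → Enumeration Q n → (f : A → B) →
           (∀ {a} → P a → Q (f a)) →
           (∀ {a b} → P a → P b → f a ≡ f b → a ≡ b) → m ℕ.≤ n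
  size-≤ E E′ f f-∈ f-inj = Fin.injective⇒≤ {f = λ i → index E′ (f-∈ (elem-∈ E i))} λ {i} {j} eq →
    elem-injective E (f-inj (elem-∈ E i) (elem-∈ E j)
      (trans (sym (elem-index E′ _)) (trans (cong (elem E′) eq) (elem-index E′ _))))

  image : ∀ {n} → Enumeration P n → (f : A → B) (g : B → A) →
          (∀ {a} → P a → Q (f a)) → (∀ {b} → Q b → P (g b)) →
          (∀ {a} → P a → g (f a) ≡ a) → (∀ {b} → Q b → f (g b) ≡ b) → Enumeration Q n
  image E f g f-∈ g-∈ gf fg = record
    { elem           = f ∘ elem E
    ; elem-∈         = f-∈ ∘ elem-∈ E
    ; elem-injective = λ {i} {j} eq → elem-injective E
        (trans (sym (gf (elem-∈ E i))) (trans (cong g eq) (gf (elem-∈ E j))))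
    ; index          = index E ∘ g-∈
    ; elem-index     = λ q → trans (cong f (elem-index E (g-∈ q))) (fg q)
    }

  product : ∀ {m n} → Enumeration P m → Enumeration Q n →
            Enumeration (λ (a , b) → P a × Q b) (m ℕ.* n)
  product {m} {n} E E′ = record
    { elem           = λ k → elem E (proj₁ (remQuot n k)) , elem E′ (proj₂ (remQuot {m} n k))
    ; elem-∈         = λ k → elem-∈ E _ , elem-∈ E′ _
    ; elem-injective = λ {k} {l} eq →
        trans (sym (Fin.combine-remQuot {m} n k)) (trans
          (cong₂ combine (elem-injective E (cong proj₁ eq)) (elem-injective E′ (cong proj₂ eq)))
          (Fin.combine-remQuot {m} n l))
    ; index          = λ (p , q) → combine (index E p) (index E′ q)
    ; elem-index     = λ (p , q) → cong₂ _,_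
        (trans (cong (elem E ∘ proj₁) (Fin.remQuot-combine {m} {n} _ _)) (elem-index E p))
        (trans (cong (elem E′ ∘ proj₂) (Fin.remQuot-combine {m} {n} (index E p) _)) (elem-index E′ q))
    }

size-unique : ∀ {A : Set} {P Q : A → Set} {m n} → Enumeration P m → Enumeration Q n →
              (∀ {a} → P a → Q a) → (∀ {a} → Q a → P a) → m ≡ n
size-unique E E′ to from = ℕ.≤-antisym
  (size-≤ E E′ id to (λ _ _ eq → eq)) (size-≤ E′ E id from (λ _ _ eq → eq))

full : ∀ {n} {P : Fin n → Set} → (∀ i → P i) → Enumeration P n
full p = record
  { elem = id ; elem-∈ = p ; elem-injective = id
  ; index = λ {i} _ → i ; elem-index = λ _ → refl }

disjointUnion : ∀ {A : Set} {P Q R : A → Set} {m n} → Enumeration P m → Enumeration Q n →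
                (∀ {a} → P a → Q a → ⊥) → (∀ {a} → P a → R a) → (∀ {a} → Q a → R a) →
                (∀ {a} → R a → P a ⊎ Q a) → Enumeration R (m ℕ.+ n)
disjointUnion {A} {P} {Q} {R} {m} {n} E E′ disjoint P⊆R Q⊆R R⊆ = record
  { elem           = el ∘ splitAt m
  ; elem-∈         = λ k → el-∈ (splitAt m k)
  ; elem-injective = λ {k} {l} eq → trans (sym (Fin.join-splitAt m n k))
      (trans (cong (join m n) (el-inj (splitAt m k) (splitAt m l) eq)) (Fin.join-splitAt m n l))
  ; index          = join m n ∘ Sum.map (index E) (index E′) ∘ R⊆
  ; elem-index     = λ r → trans (cong el (Fin.splitAt-join m n (Sum.map _ _ (R⊆ r)))) (el-index (R⊆ r))
  }
  where
  el : Fin m ⊎ Fin n → A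
  el = [ elem E , elem E′ ]′
  el-∈ : ∀ s → R (el s)
  el-∈ (inj₁ i) = P⊆R (elem-∈ E i)
  el-∈ (inj₂ j) = Q⊆R (elem-∈ E′ j)
  el-inj : ∀ s t → el s ≡ el t → s ≡ t
  el-inj (inj₁ i) (inj₁ j) eq = cong inj₁ (elem-injective E eq)
  el-inj (inj₁ i) (inj₂ j) eq = ⊥-elim (disjoint (elem-∈ E i) (subst Q (sym eq) (elem-∈ E′ j)))
  el-inj (inj₂ i) (inj₁ j) eq = ⊥-elim (disjoint (elem-∈ E j) (subst Q eq (elem-∈ E′ i)))
  el-inj (inj₂ i) (inj₂ j) eq = cong inj₂ (elem-injective E′ eq)
  el-index : ∀ {a} (s : P a ⊎ Q a) → el (Sum.map (index E) (index E′) s) ≡ a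
  el-index (inj₁ p) = elem-index E p
  el-index (inj₂ q) = elem-index E′ q

enumerate : ∀ {n} {P : Fin n → Set} → Decidable P → ∃ (Enumeration P)
enumerate {zero}  P? = 0 , record
  { elem = λ () ; elem-∈ = λ () ; elem-injective = λ { {()} }
  ; index = λ { {()} } ; elem-index = λ { {()} } }
enumerate {suc n} {P} P? with P? zero | enumerate (P? ∘ suc)
... | no ¬p | m , E = m , record
  { elem           = suc ∘ elem E
  ; elem-∈         = elem-∈ E
  ; elem-injective = elem-injective E ∘ Fin.suc-injective
  ; index          = λ { {zero} p → ⊥-elim (¬p p) ; {suc i} p → index E p }
  ; elem-index     = λ { {zero} p → ⊥-elim (¬p p) ; {suc i} p → cong suc (elem-index E p) }
  }
... | yes p | m , E = suc m , record
  { elem           = λ { zero → zero ; (suc i) → suc (elem E i) }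
  ; elem-∈         = λ { zero → p ; (suc i) → elem-∈ E i }
  ; elem-injective = λ { {zero} {zero} _ → refl
                       ; {suc i} {suc j} eq → cong suc (elem-injective E (Fin.suc-injective eq)) }
  ; index          = λ { {zero} _ → zero ; {suc i} p → suc (index E p) }
  ; elem-index     = λ { {zero} _ → refl ; {suc i} p → cong suc (elem-index E p) }
  }

-- Free actions of groups of order two and four.

half : ∀ {n} (f : Fin n → Fin n) → (∀ i → f (f i) ≡ i) → (∀ i → f i ≢ i) →
       ∃ λ m → Enumeration (λ i → i < f i) m × n ≡ m ℕ.* 2
-- The smaller point of each two-element orbit represents the orbit, and `f` exchanges the smaller
-- points with the larger ones.
half f f² f≢ with m , E ← enumerate (λ i → i Fin.<? f i) = m , E , (begin
  _        ≡⟨ size-unique (full {P = λ _ → ⊤} _) (disjointUnion {R = λ _ → ⊤} E above asym _ _ split) _ _ ⟩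
  m ℕ.+ m  ≡⟨ cong (m ℕ.+_) (ℕ.+-identityʳ m) ⟨
  2 ℕ.* m  ≡⟨ ℕ.*-comm 2 m ⟩
  m ℕ.* 2  ∎)
  where
  open ≡-Reasoning
  above : Enumeration (λ i → f i < i) m
  above = image E f f (λ {i} → subst (_< f i) (sym (f² i))) (λ {i} → subst (f i <_) (sym (f² i)))
                (λ _ → f² _) (λ _ → f² _)
  asym : ∀ {i} → i < f i → f i < i → ⊥
  asym = ℕ.<-asym
  split : ∀ {i} → ⊤ → i < f i ⊎ f i < i
  split {i} _ with Fin.<-cmp i (f i)
  ... | tri< l _ _ = inj₁ l
  ... | tri≈ _ e _ = ⊥-elim (f≢ i (sym e))
  ... | tri> _ _ g = inj₂ g

module _ {A : Set} {P : A → Set} {n : ℕ} (E : Enumeration P n) where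

  induced : (f : A → A) → (∀ {a} → P a → P (f a)) → Fin n → Fin n
  induced f f-∈ i = index E (f-∈ (elem-∈ E i))

  module _ {f : A → A} (f-∈ : ∀ {a} → P a → P (f a)) where

    induced-elem : ∀ i → elem E (induced f f-∈ i) ≡ f (elem E i)
    induced-elem i = elem-index E _

    induced² : (∀ {a} → P a → f (f a) ≡ a) → ∀ i → induced f f-∈ (induced f f-∈ i) ≡ i
    induced² f² i = elem-injective E
      (trans (induced-elem _) (trans (cong f (induced-elem i)) (f² (elem-∈ E i))))

    induced≢ : (∀ {a} → P a → f a ≢ a) → ∀ i → induced f f-∈ i ≢ i
    induced≢ f≢ i eq = f≢ (elem-∈ E i) (trans (sym (induced-elem i)) (cong (elem E) eq))

  free-involution⇒2∣ : (f : A → A) → (∀ {a} → P a → P (f a)) →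
                       (∀ {a} → P a → f (f a) ≡ a) → (∀ {a} → P a → f a ≢ a) → 2 ∣ n
  free-involution⇒2∣ f f-∈ f² f≢
    with m , _ , eq ← half (induced f f-∈) (induced² f-∈ f²) (induced≢ f-∈ f≢) = divides m eq

module _ {A : Set} {P : A → Set} {n : ℕ} (E : Enumeration P n) where

  -- Halving twice: `g` commutes with `f`, so it acts on the orbits of `f`, and freeness makes this
  -- a fixed-point-free involution. The alternative in the hypothesis on `g (g a)` covers both a
  -- four-group and a cyclic group generated by a square root `g` of `f`.
  free-square⇒4∣ : (f g : A → A) → (∀ {a} → P a → P (f a)) → (∀ {a} → P a → P (g a)) →
                   (∀ {a} → P a → f (f a) ≡ a) → (∀ {a} → P a → f a ≢ a) →
                   (∀ {a} → P a → f (g a) ≡ g (f a)) →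
                   (∀ {a} → P a → g (g a) ≡ a ⊎ g (g a) ≡ f a) →
                   (∀ {a} → P a → g a ≢ a) → (∀ {a} → P a → g a ≢ f a) → 4 ∣ n
  free-square⇒4∣ f g f-∈ g-∈ f² f≢ fg g² g≢ g≢f
    with m , H , eq ← half (induced E f f-∈) (induced² E f-∈ f²) (induced≢ E f-∈ f≢) =
    subst (4 ∣_) (sym eq) (*-monoˡ-∣ 2
      (free-involution⇒2∣ H ḡ (λ _ → lower-< _) ḡ² (λ _ → ḡ≢)))
    where
    f̂ ĝ : Fin n → Fin n
    f̂ = induced E f f-∈
    ĝ = induced E g g-∈

    f̂-elem : ∀ i → elem E (f̂ i) ≡ f (elem E i)
    f̂-elem = induced-elem E f-∈

    ĝ-elem : ∀ i → elem E (ĝ i) ≡ g (elem E i)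
    ĝ-elem = induced-elem E g-∈

    f̂² : ∀ i → f̂ (f̂ i) ≡ i
    f̂² = induced² E f-∈ f²

    f̂ĝ : ∀ i → f̂ (ĝ i) ≡ ĝ (f̂ i)
    f̂ĝ i = elem-injective E (begin
      elem E (f̂ (ĝ i))  ≡⟨ f̂-elem _ ⟩
      f (elem E (ĝ i))   ≡⟨ cong f (ĝ-elem i) ⟩
      f (g (elem E i))   ≡⟨ fg (elem-∈ E i) ⟩
      g (f (elem E i))   ≡⟨ cong g (f̂-elem i) ⟨
      g (elem E (f̂ i))  ≡⟨ ĝ-elem _ ⟨
      elem E (ĝ (f̂ i))  ∎)
      where open ≡-Reasoning

    ĝ² : ∀ i → ĝ (ĝ i) ≡ i ⊎ ĝ (ĝ i) ≡ f̂ i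
    ĝ² i = Sum.map (λ eq → elem-injective E (trans ĝĝ eq))
                   (λ eq → elem-injective E (trans ĝĝ (trans eq (sym (f̂-elem i)))))
                   (g² (elem-∈ E i))
      where
      ĝĝ : elem E (ĝ (ĝ i)) ≡ g (g (elem E i))
      ĝĝ = trans (ĝ-elem _) (cong g (ĝ-elem i))

    ĝ≢ : ∀ i → ĝ i ≢ i
    ĝ≢ = induced≢ E g-∈ g≢

    ĝ≢f̂ : ∀ i → ĝ i ≢ f̂ i
    ĝ≢f̂ i eq = g≢f (elem-∈ E i)
      (trans (sym (ĝ-elem i)) (trans (cong (elem E) eq) (f̂-elem i)))

    lower : Fin n → Fin n
    lower i with i Fin.<? f̂ i
    ... | yes _ = i
    ... | no  _ = f̂ i

    lower-< : ∀ i → lower i < f̂ (lower i)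
    lower-< i with i Fin.<? f̂ i
    ... | yes l = l
    ... | no ≮ with Fin.<-cmp i (f̂ i)
    ...   | tri< l _ _ = ⊥-elim (≮ l)
    ...   | tri≈ _ e _ = ⊥-elim (induced≢ E f-∈ f≢ i (sym e))
    ...   | tri> _ _ l = subst (f̂ i <_) (sym (f̂² i)) l

    lower-orbit : ∀ i → lower i ≡ i ⊎ lower i ≡ f̂ i
    lower-orbit i with i Fin.<? f̂ i
    ... | yes _ = inj₁ refl
    ... | no  _ = inj₂ refl

    lower-unique : ∀ {i j} → i < f̂ i → j < f̂ j → j ≡ i ⊎ j ≡ f̂ i → j ≡ i
    lower-unique _ _ (inj₁ eq) = eq
    lower-unique {i} l l′ (inj₂ refl) = ⊥-elim (ℕ.<-asym l (subst (f̂ i <_) (f̂² i) l′))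

    flip : ∀ {i j} → j ≡ i ⊎ j ≡ f̂ i → f̂ j ≡ i ⊎ f̂ j ≡ f̂ i
    flip (inj₁ refl) = inj₂ refl
    flip (inj₂ refl) = inj₁ (f̂² _)

    -- The action of `g` on the orbits of `f`, each orbit being replaced by its smaller point.
    ḡ : Fin n → Fin n
    ḡ = lower ∘ ĝ

    -- Each `lower` inserts at most one `f̂`. As `f̂` commutes with `ĝ`, these factors collect in
    -- front of `ĝ (ĝ i)`, which is in the orbit of `i` already.
    ḡ²-orbit : ∀ i → ḡ (ḡ i) ≡ i ⊎ ḡ (ḡ i) ≡ f̂ i
    ḡ²-orbit i with lower (ĝ i) | lower-orbit (ĝ i)
    ... | _ | inj₁ refl with lower (ĝ (ĝ i)) | lower-orbit (ĝ (ĝ i))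
    ...   | _ | inj₁ refl = ĝ² i
    ...   | _ | inj₂ refl = flip (ĝ² i)
    ḡ²-orbit i | _ | inj₂ refl with lower (ĝ (f̂ (ĝ i))) | lower-orbit (ĝ (f̂ (ĝ i)))
    ...   | _ | inj₁ refl rewrite sym (f̂ĝ (ĝ i)) = flip (ĝ² i)
    ...   | _ | inj₂ refl rewrite sym (f̂ĝ (ĝ i)) | f̂² (ĝ (ĝ i)) = ĝ² i

    ḡ² : ∀ {i} → i < f̂ i → ḡ (ḡ i) ≡ i
    ḡ² {i} l = lower-unique l (lower-< (ĝ (ḡ i))) (ḡ²-orbit i)

    -- An orbit fixed by `g` would give `ĝ i ≡ i` or `ĝ i ≡ f̂ i`, and both are excluded.
    ḡ≢ : ∀ {i} → ḡ i ≢ i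
    ḡ≢ {i} eq with lower (ĝ i) | lower-orbit (ĝ i)
    ... | _ | inj₁ refl = ĝ≢ i eq
    ... | _ | inj₂ refl = ĝ≢f̂ i (trans (sym (f̂² _)) (cong f̂ eq))

odd-2∣ : ∀ {m} k → ¬ 2 ∣ m → 2 ∣ m ℕ.* k → 2 ∣ k
odd-2∣ {m} k odd 2∣mk = [ (λ 2∣m → ⊥-elim (odd 2∣m)) , id ]′ (euclidsLemma m k prime[2] 2∣mk)

-- Euclid's lemma for the prime 2, applied once for each factor 2 of 4.
odd-4∣ : ∀ {m} k → ¬ 2 ∣ m → 4 ∣ m ℕ.* k → 4 ∣ k
odd-4∣ {m} k odd 4∣mk with odd-2∣ k odd (∣-trans (divides 2 refl) 4∣mk)
... | divides j refl = *-monoˡ-∣ 2 (odd-2∣ j odd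
  (*-cancelʳ-∣ 2 (subst (4 ∣_) (sym (ℕ.*-assoc m j 2)) 4∣mk)))

-- Least representatives of equivalence classes.

least : ∀ {n} {P : Fin n → Set} → Decidable P → ∃ P → ∃ λ i → P i × (∀ {j} → P j → i ≤ j)
least {suc n} P? (a , p) with P? zero
... | yes p₀ = zero , p₀ , λ _ → z≤n
least {suc n} P? (zero  , p) | no ¬p₀ = ⊥-elim (¬p₀ p)
least {suc n} P? (suc a , p) | no ¬p₀ with i , pᵢ , min ← least (P? ∘ suc) (a , p) =
  suc i , pᵢ , λ { {zero} p₀ → ⊥-elim (¬p₀ p₀) ; {suc j} pⱼ → s≤s (min pⱼ) }

module Representative {n} {_∼_ : Fin n → Fin n → Set} (isEquivalence : IsEquivalence _∼_)
                      (_∼?_ : Binary.Decidable _∼_) where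
  private module E = IsEquivalence isEquivalence

  abstract
    rep : Fin n → Fin n
    rep x = proj₁ (least (x ∼?_) (x , E.refl))

    ∼-rep : ∀ x → x ∼ rep x
    ∼-rep x = proj₁ (proj₂ (least (x ∼?_) (x , E.refl)))

    rep-cong : ∀ {x y} → x ∼ y → rep x ≡ rep y
    rep-cong {x} {y} x∼y = Fin.≤-antisym
      (proj₂ (proj₂ (least (x ∼?_) (x , E.refl))) (E.trans x∼y (∼-rep y)))
      (proj₂ (proj₂ (least (y ∼?_) (y , E.refl))) (E.trans (E.sym x∼y) (∼-rep x)))

  rep-injective : ∀ {x y} → rep x ≡ rep y → x ∼ y
  rep-injective {x} {y} eq = E.trans (∼-rep x) (subst (_∼ y) (sym eq) (E.sym (∼-rep y)))

  rep-idem : ∀ x → rep (rep x) ≡ rep x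
  rep-idem x = sym (rep-cong (∼-rep x))

-- Right cosets and double cosets in a finite group.

module FiniteGroup {n : ℕ} {mul : Fin n → Fin n → Fin n} {unit : Fin n} {inv : Fin n → Fin n}
                   (isGroup : IsGroup _≡_ mul unit inv) where

  group : Group _ _
  group = record { isGroup = isGroup }

  open Group group
    using (_∙_; ε; _⁻¹; assoc; identityˡ; identityʳ; inverseˡ; inverseʳ)
    renaming (Carrier to G)
  open GroupProperties group
  open ≡-Reasoning

  record IsSubgroup (H : G → Set) : Set where
    field
      ∙-closed  : ∀ {x y} → H x → H y → H (x ∙ y)
      ε-closed  : H ε
      ⁻¹-closed : ∀ {x} → H x → H (x ⁻¹)

  //-telescope : ∀ x y z → (x ∙ y ⁻¹) ∙ (y ∙ z ⁻¹) ≡ x ∙ z ⁻¹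
  //-telescope x y z = begin
    (x ∙ y ⁻¹) ∙ (y ∙ z ⁻¹)  ≡⟨ assoc _ _ _ ⟨
    ((x ∙ y ⁻¹) ∙ y) ∙ z ⁻¹  ≡⟨ cong (_∙ z ⁻¹) (//-rightDividesˡ y x) ⟩
    x ∙ z ⁻¹                 ∎

  module Cosets {H : G → Set} (H? : Decidable H) (isSubgroup : IsSubgroup H) where
    open IsSubgroup isSubgroup

    infix 4 _∼_ _≈_

    -- The classes are the right cosets `Hx`.
    _∼_ : G → G → Set
    x ∼ y = H (x ∙ y ⁻¹)

    ∼-isEquivalence : IsEquivalence _∼_
    ∼-isEquivalence = record
      { refl  = λ {x} → subst H (sym (inverseʳ x)) ε-closed
      ; sym   = λ {x} {y} p → subst H (⁻¹-anti-homo-// x y) (⁻¹-closed p)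
      ; trans = λ {x} {y} {z} p q → subst H (//-telescope x y z) (∙-closed p q)
      }

    module ∼ = IsEquivalence ∼-isEquivalence
    open Representative ∼-isEquivalence (λ x y → H? (x ∙ y ⁻¹)) public

    ∙∼ : ∀ {h} x → H h → (h ∙ x) ∼ x
    ∙∼ {h} x p = subst H (sym (//-rightDividesʳ x h)) p

    -- The classes are the double cosets `HxH`.
    _≈_ : G → G → Set
    x ≈ y = ∃ λ h → ∃ λ k → H h × H k × y ≡ (h ∙ x) ∙ k

    abstract
      _≈?_ : Binary.Decidable _≈_
      x ≈? y = any? λ h → any? λ k → H? h ×-dec H? k ×-dec (y ≟ (h ∙ x) ∙ k)

    solve-≈ : ∀ {h x k y} → y ≡ (h ∙ x) ∙ k → x ≡ (h ⁻¹ ∙ y) ∙ k ⁻¹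
    solve-≈ {h} {x} {k} {y} refl = begin
      x                              ≡⟨ \\-leftDividesʳ h x ⟨
      h ⁻¹ ∙ (h ∙ x)                 ≡⟨ //-rightDividesʳ k _ ⟨
      ((h ⁻¹ ∙ (h ∙ x)) ∙ k) ∙ k ⁻¹  ≡⟨ cong (_∙ k ⁻¹) (assoc _ _ _) ⟩
      (h ⁻¹ ∙ ((h ∙ x) ∙ k)) ∙ k ⁻¹  ∎

    ≈-isEquivalence : IsEquivalence _≈_
    ≈-isEquivalence = record
      { refl  = λ {x} → ε , ε , ε-closed , ε-closed ,
          sym (trans (identityʳ _) (identityˡ x))
      ; sym   = λ (h , k , p , q , eq) → _ , _ , ⁻¹-closed p , ⁻¹-closed q , solve-≈ eq
      ; trans = λ {x} → λ { (h , k , p , q , refl) (h′ , k′ , p′ , q′ , refl) →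
          _ , _ , ∙-closed p′ p , ∙-closed q q′ , (begin
            (h′ ∙ ((h ∙ x) ∙ k)) ∙ k′   ≡⟨ cong (_∙ k′) (assoc _ _ _) ⟨
            ((h′ ∙ (h ∙ x)) ∙ k) ∙ k′   ≡⟨ assoc _ _ _ ⟩
            (h′ ∙ (h ∙ x)) ∙ (k ∙ k′)   ≡⟨ cong (_∙ (k ∙ k′)) (assoc _ _ _) ⟨
            ((h′ ∙ h) ∙ x) ∙ (k ∙ k′)   ∎) }
      }

    open Representative ≈-isEquivalence _≈?_ public
      renaming (rep to rep₂; ∼-rep to ≈-rep₂; rep-cong to rep₂-cong
               ; rep-injective to rep₂-injective; rep-idem to rep₂-idem)

    ∼⇒≈ : ∀ {x y} → x ∼ y → x ≈ y
    ∼⇒≈ {x} {y} p = y ∙ x ⁻¹ , ε , ∼.sym p , ε-closed ,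
      sym (trans (identityʳ _) (//-rightDividesˡ x y))

    ⁻¹-≈ : ∀ {x y} → x ≈ y → x ⁻¹ ≈ y ⁻¹
    ⁻¹-≈ {x} (h , k , p , q , refl) = _ , _ , ⁻¹-closed q , ⁻¹-closed p , (begin
      ((h ∙ x) ∙ k) ⁻¹        ≡⟨ ⁻¹-anti-homo-∙ _ _ ⟩
      k ⁻¹ ∙ (h ∙ x) ⁻¹       ≡⟨ cong (k ⁻¹ ∙_) (⁻¹-anti-homo-∙ _ _) ⟩
      k ⁻¹ ∙ (x ⁻¹ ∙ h ⁻¹)    ≡⟨ assoc _ _ _ ⟨
      (k ⁻¹ ∙ x ⁻¹) ∙ h ⁻¹    ∎)

    -- One `x` for each right coset inside the double coset represented by `c`, so that `index₂ c`
    -- is |HcH| / |H| when `rep₂ c ≡ c`.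
    IsCosetRep : G → G → Set
    IsCosetRep c x = rep x ≡ x × rep₂ x ≡ c

    abstract
      index₂ : G → ℕ
      index₂ c = proj₁ (enumerate (λ x → (rep x ≟ x) ×-dec (rep₂ x ≟ c)))

      cosetReps : ∀ c → Enumeration (IsCosetRep c) (index₂ c)
      cosetReps c = proj₂ (enumerate (λ x → (rep x ≟ x) ×-dec (rep₂ x ≟ c)))

    rep-isCosetRep : ∀ {c} x → rep₂ x ≡ c → IsCosetRep c (rep x)
    rep-isCosetRep x eq = rep-idem x , trans (sym (rep₂-cong (∼⇒≈ (∼-rep x)))) eq

    -- Every `x` in the double coset is uniquely `h ∙ t y` with `y = rep x` and `h` in `H`; those
    -- with `h` in `K` are kept. With `K = H` and `t = id` this counts the double coset itself; with
    -- `K = H ∩ B` and values of `t` in `B` it counts its intersection with `B`.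
    translates : ∀ {K : G → Set} {k} c → (∀ {x} → K x → H x) →
                 (t : G → G) → (∀ x → t x ∼ x) → Enumeration K k →
                 Enumeration (λ x → rep₂ x ≡ c × K (x ∙ t (rep x) ⁻¹)) (index₂ c ℕ.* k)
    translates {K} c K⊆H t t∼ EK = image (product (cosetReps c) EK)
      (λ (y , h) → h ∙ t y) (λ x → rep x , x ∙ t (rep x) ⁻¹)
      (λ { {y , h} ((ry , dy) , p) →
        trans (rep₂-cong (∼⇒≈ (f∼ y p))) dy ,
        subst K (sym (remove y p ry)) p })
      (λ { {x} (dx , p) → rep-isCosetRep x dx , p })
      (λ { {y , h} ((ry , dy) , p) → cong₂ _,_ (trans (rep-cong (f∼ y p)) ry) (remove y p ry) })
      (λ {x} _ → //-rightDividesˡ _ x)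
      where
      f∼ : ∀ {h} y → K h → (h ∙ t y) ∼ y
      f∼ y p = ∼.trans (∙∼ (t y) (K⊆H p)) (t∼ y)
      remove : ∀ {h} y → K h → rep y ≡ y → ((h ∙ t y) ∙ t (rep (h ∙ t y)) ⁻¹) ≡ h
      remove {h} y p ry = trans (cong (λ z → (h ∙ t y) ∙ t z ⁻¹) (trans (rep-cong (f∼ y p)) ry))
                                (//-rightDividesʳ (t y) h)

    -- The representative of the inverse double coset.
    bar : G → G
    bar c = rep₂ (c ⁻¹)

    rep₂-⁻¹ : ∀ {c} x → rep₂ x ≡ c → rep₂ (x ⁻¹) ≡ bar c
    rep₂-⁻¹ x refl = rep₂-cong (⁻¹-≈ (≈-rep₂ x))

    bar-involutive : ∀ {c} → rep₂ c ≡ c → bar (bar c) ≡ c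
    bar-involutive {c} eq = trans (sym (rep₂-⁻¹ (c ⁻¹) refl)) (trans (cong rep₂ (⁻¹-involutive c)) eq)

    -- Inversion turns right cosets into left cosets, so elements are counted instead: inversion is
    -- a bijection between the two double cosets, and the factor |H| cancels.
    index₂-bar : ∀ {c} → rep₂ c ≡ c → index₂ (bar c) ≡ index₂ c
    index₂-bar {c} eq = ℕ.*-cancelʳ-≡ _ _ _ {{ℕ.>-nonZero H-nonempty}}
      (size-unique (image (doubleCoset (bar c)) _⁻¹ _⁻¹
        (λ {x} e → trans (rep₂-⁻¹ x e) (bar-involutive eq)) (λ {x} e → rep₂-⁻¹ x e)
        (λ _ → ⁻¹-involutive _) (λ _ → ⁻¹-involutive _)) (doubleCoset c) id id)
      where
      EH : Enumeration H (proj₁ (enumerate H?))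
      EH = proj₂ (enumerate H?)
      doubleCoset : ∀ c → Enumeration (λ x → rep₂ x ≡ c) (index₂ c ℕ.* proj₁ (enumerate H?))
      doubleCoset c = image (translates c id id (λ _ → ∼.refl) EH) id id
        proj₁ (λ {x} e → e , ∼-rep x) (λ _ → refl) (λ _ → refl)
      H-nonempty : 0 ℕ.< proj₁ (enumerate H?)
      H-nonempty = ℕ.≤-<-trans z≤n (Fin.toℕ<n (index EH ε-closed))

    -- Pairing the right cosets and linking the partners.

    InvolutionCondition : Set
    InvolutionCondition = ∀ {c} → rep₂ c ≡ c → bar c ≡ c → ¬ 2 ∣ index₂ c →
                          ∃ λ t → rep₂ t ≡ c × t ⁻¹ ≡ t

    -- The position is a natural number and not an element of `Fin (index₂ c)`, so that positions in
    -- a double coset and in its inverse can be added and compared without transport.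
    Position : G → ℕ → G → Set
    Position c k x = ∃ λ i → toℕ i ≡ k × elem (cosetReps c) i ≡ x

    position-∈ : ∀ {c k x} → Position c k x → IsCosetRep c x
    position-∈ {c} (i , _ , refl) = elem-∈ (cosetReps c) i

    position-functional : ∀ {c k x y} → Position c k x → Position c k y → x ≡ y
    position-functional {c} (i , e , refl) (j , e′ , refl) =
      cong (elem (cosetReps c)) (toℕ-injective (trans e (sym e′)))

    position-injective : ∀ {c k l x} → Position c k x → Position c l x → k ≡ l
    position-injective {c} (i , refl , e) (j , refl , e′) =
      cong toℕ (elem-injective (cosetReps c) (trans e (sym e′)))

    -- Pairing in opposite order leaves only a middle coset, if any, paired with itself when HcH = Hc⁻¹H.
    record Partner (x y : G) : Set where
      field
        {c}    : G
        {k l}  : ℕ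
        c-rep  : rep₂ c ≡ c
        x-at   : Position c k x
        y-at   : Position (bar c) l y
        total  : suc (k ℕ.+ l) ≡ index₂ c

    partner-sym : ∀ {x y} → Partner x y → Partner y x
    partner-sym p = record
      { c-rep = rep₂-idem _
      ; x-at  = y-at
      ; y-at  = subst (λ d → Position d _ _) (sym (bar-involutive c-rep)) x-at
      ; total = trans (cong suc (ℕ.+-comm _ k)) (trans total (sym (index₂-bar c-rep)))
      }
      where open Partner p

    -- `x` determines `c` as the representative of its double coset, then `k`, then `l` through
    -- `total`, and so the partner.
    partner-unique : ∀ {x y z} → Partner x y → Partner x z → y ≡ z
    partner-unique record { k = k ; l = l ; x-at = x-at ; y-at = y-at ; total = total }
                   record { l = l′ ; x-at = x-at′ ; y-at = y-at′ ; total = total′ }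
      with trans (sym (proj₂ (position-∈ x-at))) (proj₂ (position-∈ x-at′))
    ... | refl with position-injective x-at x-at′
    ... | refl with ℕ.+-cancelˡ-≡ k l l′ (ℕ.suc-injective (trans total (sym total′)))
    ... | refl = position-functional y-at y-at′

    abstract
      partner : ∀ {x} → rep x ≡ x → ∃ (Partner x)
      partner {x} eq = elem (cosetReps (bar (rep₂ x))) j , record
        { c-rep = rep₂-idem x
        ; x-at  = i , refl , elem-index (cosetReps _) (eq , refl)
        ; y-at  = j , Fin.toℕ-fromℕ< _ , refl
        ; total = ℕ.m+[n∸m]≡n (Fin.toℕ<n i)
        }
        where
        i : Fin (index₂ (rep₂ x))
        i = index (cosetReps (rep₂ x)) (eq , refl)
        j : Fin (index₂ (bar (rep₂ x)))
        -- Positions start at 0, so the mirror image of `i` is `index₂ (rep₂ x) - 1 - i`.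
        j = fromℕ< {index₂ (rep₂ x) ℕ.∸ suc (toℕ i)}
              (subst (index₂ (rep₂ x) ℕ.∸ suc (toℕ i) ℕ.<_) (sym (index₂-bar (rep₂-idem x)))
                (ℕ.∸-monoʳ-< (s≤s z≤n) (Fin.toℕ<n i)))

    -- The last clause makes the element chosen for a self-paired coset its own inverse; otherwise
    -- an inverse-closed set would meet that coset twice.
    Links : G → G → G → Set
    Links x y z = z ∼ x × z ⁻¹ ∼ y × (x ≡ y → z ⁻¹ ≡ z)

    abstract
      links? : ∀ x y → Dec (∃ (Links x y))
      links? x y = any? λ z → H? _ ×-dec H? _ ×-dec ((x ≟ y) →-dec (z ⁻¹ ≟ z))

    -- The right coset of `x` meets the left coset `y ⁻¹ H`: if `y = h ∙ x ⁻¹ ∙ k`, then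
    -- `z = k ⁻¹ ∙ x` has inverse `x ⁻¹ ∙ k = h ⁻¹ ∙ y`.
    link-distinct : ∀ {x y} → x ⁻¹ ≈ y → ∃ λ z → z ∼ x × z ⁻¹ ∼ y
    link-distinct {x} (h , k , hh , hk , refl) =
      k ⁻¹ ∙ x , ∙∼ x (⁻¹-closed hk) , subst (_∼ h ∙ x ⁻¹ ∙ k) (sym z⁻¹≡) (∙∼ _ (⁻¹-closed hh))
      where
      z⁻¹≡ : (k ⁻¹ ∙ x) ⁻¹ ≡ h ⁻¹ ∙ (h ∙ x ⁻¹ ∙ k)
      z⁻¹≡ = begin
        (k ⁻¹ ∙ x) ⁻¹            ≡⟨ ⁻¹-anti-homo-\\ k x ⟩
        x ⁻¹ ∙ k                 ≡⟨ \\-leftDividesʳ h _ ⟨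
        h ⁻¹ ∙ (h ∙ (x ⁻¹ ∙ k))  ≡⟨ cong (h ⁻¹ ∙_) (assoc _ _ _) ⟨
        h ⁻¹ ∙ (h ∙ x ⁻¹ ∙ k)    ∎

    -- Conjugating `t` by elements of `H` reaches every right coset of its double coset: for
    -- `x = h ∙ t ∙ k`, the conjugate `k ⁻¹ ∙ t ∙ k` is `k ⁻¹ ∙ h ⁻¹ ∙ x`.
    conjugate-involution : ∀ {t x} → t ≈ x → t ⁻¹ ≡ t → ∃ λ z → z ∼ x × z ⁻¹ ≡ z
    conjugate-involution {t} (h , k , hh , hk , refl) t⁻¹≡t = z , z∼x , z⁻¹≡z
      where
      z : G
      z = k ⁻¹ ∙ (t ∙ k)
      z∼x : z ∼ h ∙ t ∙ k
      z∼x = subst (_∼ h ∙ t ∙ k) (begin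
        k ⁻¹ ∙ h ⁻¹ ∙ (h ∙ t ∙ k)      ≡⟨ cong (k ⁻¹ ∙ h ⁻¹ ∙_) (assoc _ _ _) ⟩
        k ⁻¹ ∙ h ⁻¹ ∙ (h ∙ (t ∙ k))    ≡⟨ assoc _ _ _ ⟩
        k ⁻¹ ∙ (h ⁻¹ ∙ (h ∙ (t ∙ k)))  ≡⟨ cong (k ⁻¹ ∙_) (\\-leftDividesʳ h _) ⟩
        z                              ∎)
        (∙∼ _ (∙-closed (⁻¹-closed hk) (⁻¹-closed hh)))
      z⁻¹≡z : z ⁻¹ ≡ z
      z⁻¹≡z = begin
        z ⁻¹                 ≡⟨ ⁻¹-anti-homo-\\ k _ ⟩
        (t ∙ k) ⁻¹ ∙ k       ≡⟨ cong (_∙ k) (⁻¹-anti-homo-∙ t k) ⟩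
        k ⁻¹ ∙ t ⁻¹ ∙ k      ≡⟨ cong (λ u → k ⁻¹ ∙ u ∙ k) t⁻¹≡t ⟩
        k ⁻¹ ∙ t ∙ k         ≡⟨ assoc _ _ _ ⟩
        z                    ∎

    -- A self-paired coset occupies the middle position, so `k = l` and the number of cosets is
    -- `2k + 1`.
    self-partner⇒odd : ∀ {x} (p : Partner x x) →
                       bar (Partner.c p) ≡ Partner.c p × ¬ 2 ∣ index₂ (Partner.c p)
    self-partner⇒odd {x} p = bar≡ , λ (divides m eq) → ℕ.even≢odd m k (begin
        2 ℕ.* m        ≡⟨ ℕ.*-comm 2 m ⟩
        m ℕ.* 2        ≡⟨ eq ⟨
        index₂ c       ≡⟨ total ⟨
        suc (k ℕ.+ l)  ≡⟨ cong (λ i → suc (k ℕ.+ i)) (trans (sym k≡l) (sym (ℕ.+-identityʳ k))) ⟩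
        suc (2 ℕ.* k)  ∎)
      where
      open Partner p
      bar≡ : bar c ≡ c
      bar≡ = trans (sym (proj₂ (position-∈ y-at))) (proj₂ (position-∈ x-at))
      k≡l : k ≡ l
      k≡l = position-injective x-at (subst (λ d → Position d l x) bar≡ y-at)

    link : InvolutionCondition → ∀ {x y} → Partner x y → ∃ (Links x y)
    link involution {x} {y} p with x ≟ y
    ... | no x≢y with z , z∼x , z⁻¹∼y ← link-distinct (rep₂-injective
            (trans (rep₂-⁻¹ x (proj₂ (position-∈ (Partner.x-at p))))
                   (sym (proj₂ (position-∈ (Partner.y-at p)))))) =
      z , z∼x , z⁻¹∼y , λ x≡y → ⊥-elim (x≢y x≡y)
    ... | yes refl with bar≡ , odd ← self-partner⇒odd p
      with t , t∈ , t⁻¹≡t ← involution (Partner.c-rep p) bar≡ odd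
      with z , z∼x , z⁻¹≡z ← conjugate-involution
             (rep₂-injective (trans t∈ (sym (proj₂ (position-∈ (Partner.x-at p)))))) t⁻¹≡t =
      z , z∼x , subst (_∼ x) (sym z⁻¹≡z) z∼x , λ _ → z⁻¹≡z

    abstract
      chosen : G → G → G
      chosen x y with links? x y
      ... | yes (z , _) = z
      -- A default that partners never meet: under the involution condition they have a link.
      ... | no  _       = ε

      chosen-links : ∀ {x y} → ∃ (Links x y) → Links x y (chosen x y)
      chosen-links {x} {y} l with links? x y
      ... | yes (_ , p) = p
      ... | no  ¬l      = ⊥-elim (¬l l)

      -- Separate choices for `(x , y)` and `(y , x)` need not be inverse to each other. A choice is
      -- made for one order only and inverted for the other.
      connection : G → G → G
      connection x y with x ≤? y
      ... | yes _ = chosen x y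
      ... | no  _ = chosen y x ⁻¹

      chosen-∼ : InvolutionCondition → ∀ {x y} → Partner x y → Links x y (chosen x y)
      chosen-∼ involution p = chosen-links (link involution p)

      connection-∼ : InvolutionCondition → ∀ {x y} → Partner x y → connection x y ∼ x
      connection-∼ involution {x} {y} p with x ≤? y
      ... | yes _ = proj₁ (chosen-∼ involution p)
      ... | no  _ = proj₁ (proj₂ (chosen-∼ involution (partner-sym p)))

      connection-⁻¹ : InvolutionCondition → ∀ {x y} → Partner x y → connection x y ⁻¹ ≡ connection y x
      connection-⁻¹ involution {x} {y} p with x ≤? y | y ≤? x
      ... | no  _ | yes _ = ⁻¹-involutive _
      ... | yes _ | no  _ = refl
      ... | no x≰y | no y≰x = ⊥-elim ([ x≰y , y≰x ]′ (Fin.≤-total x y))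
      -- The coset is its own partner here, and the last clause of `Links` applies.
      ... | yes x≤y | yes y≤x with refl ← Fin.≤-antisym x≤y y≤x =
        proj₂ (proj₂ (chosen-∼ involution p)) refl

    -- An inverse-closed transversal of the right cosets other than `H`.

    module Transversal (involution : InvolutionCondition) where

      Connection : G → Set
      Connection z = ¬ H z × ∃ λ x → ∃ λ y → Partner x y × z ≡ connection x y

      Connection-⁻¹ : ∀ {z} → Connection z → Connection (z ⁻¹)
      Connection-⁻¹ {z} (z∉H , x , y , p , eq) =
        (λ h → z∉H (subst H (⁻¹-involutive z) (⁻¹-closed h))) ,
        y , x , partner-sym p , trans (cong _⁻¹ eq) (connection-⁻¹ involution p)

      -- `z ∙ g` is in `H` exactly when `z` is in the right coset of `g ⁻¹`, so the connection
      -- belonging to that coset is taken.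
      Connection-exists : ∀ {g} → ¬ H g → ∃ λ z → Connection z × H (z ∙ g)
      Connection-exists {g} g∉H with y , p ← partner (rep-idem (g ⁻¹)) =
        z , ((λ h → g∉H (subst H g≡ (∙-closed (⁻¹-closed h) zg))) , _ , _ , p , refl) , zg
        where
        z : G
        z = connection (rep (g ⁻¹)) y
        zg : H (z ∙ g)
        zg = subst (λ u → H (z ∙ u)) (⁻¹-involutive g)
                   (∼.trans (connection-∼ involution p) (∼.sym (∼-rep (g ⁻¹))))
        g≡ : z ⁻¹ ∙ (z ∙ g) ≡ g
        g≡ = \\-leftDividesʳ z g

      connection-injective : ∀ {x y x′ y′} → Partner x y → Partner x′ y′ →
                             connection x y ∼ connection x′ y′ → connection x y ≡ connection x′ y′
      connection-injective {x} {y} {x′} {y′} p p′ z∼w =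
        cong₂ connection x≡x′ (partner-unique p (subst (λ u → Partner u y′) (sym x≡x′) p′))
        where
        x≡x′ : x ≡ x′
        x≡x′ = begin
          x       ≡⟨ proj₁ (position-∈ (Partner.x-at p)) ⟨
          rep x   ≡⟨ rep-cong (∼.trans (∼.sym (connection-∼ involution p))
                                       (∼.trans z∼w (connection-∼ involution p′))) ⟩
          rep x′  ≡⟨ proj₁ (position-∈ (Partner.x-at p′)) ⟩
          x′      ∎

      -- Both `z` and `w` lie in the right coset of `g ⁻¹`, and a coset determines its partner and
      -- thereby its connection.
      Connection-unique : ∀ {g z w} → Connection z → Connection w → H (z ∙ g) → H (w ∙ g) → z ≡ w
      Connection-unique {g} (_ , _ , _ , p , refl) (_ , _ , _ , p′ , refl) zg wg =
        connection-injective p p′ (∼.trans (to-∼ zg) (∼.sym (to-∼ wg)))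
        where
        to-∼ : ∀ {u} → H (u ∙ g) → u ∼ g ⁻¹
        to-∼ {u} = subst (λ v → H (u ∙ v)) (sym (⁻¹-involutive g))

  -- The involution condition from a count modulo 4.

  open IsSubgroup

  module _ {H B : G → Set} (H? : Decidable H) (B? : Decidable B)
           (H≤ : IsSubgroup H) (B≤ : IsSubgroup B)
           (G≡HB : ∀ x → ∃ λ t → B t × H (t ∙ x ⁻¹))
           {k} (H∩B : Enumeration (λ x → H x × B x) k) (4∤k : ¬ 4 ∣ k)
           {r} (r∈H : H r) (r∈B : B r) (r⁻¹≡r : r ⁻¹ ≡ r) (r≢ε : r ≢ ε)
           (r-nonsquare : ∀ x → x ∙ x ≢ r) where

    open Cosets H? H≤

    involutionCondition : InvolutionCondition
    involutionCondition {c} c-rep bar≡ odd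
      with any? (λ t → (rep₂ t ≟ c) ×-dec B? t ×-dec (t ⁻¹ ≟ t))
    -- Searching inside `B` is enough: if the search fails, 4 divides the size `index₂ c * k` of
    -- `D∩B`, although `index₂ c` is odd and 4 does not divide `k`.
    ... | yes (t , t∈ , _ , eq) = t , t∈ , eq
    ... | no none = ⊥-elim (4∤k (odd-4∣ _ odd (subst (4 ∣_) (sym size≡)
        (∣m∣n⇒∣m+n 4∣nonCommuting 4∣commuting))))
      where
      D∩B : G → Set
      D∩B x = rep₂ x ≡ c × B x

      -- By `G≡HB` each right coset has a representative in `B`. Relative to it, an element of the
      -- coset is in `B` exactly when its factor from `H` is in `H ∩ B`.
      sizeD∩B : Enumeration D∩B (index₂ c ℕ.* k)
      sizeD∩B = image (translates c proj₁ (proj₁ ∘ G≡HB) (λ x → proj₂ (proj₂ (G≡HB x))) H∩B) id id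
        (λ {x} (e , _ , b) → e , subst B (//-rightDividesˡ _ x) (∙-closed B≤ b (t∈B x)))
        (λ {x} (e , b) → e , ∼.trans (∼-rep x) (∼.sym (proj₂ (proj₂ (G≡HB (rep x))))) ,
                         ∙-closed B≤ b (⁻¹-closed B≤ (t∈B x)))
        (λ _ → refl) (λ _ → refl)
        where
        t∈B : ∀ x → B (proj₁ (G≡HB (rep x)))
        t∈B x = proj₁ (proj₂ (G≡HB (rep x)))

      Commuting NonCommuting : G → Set
      Commuting    x = D∩B x × r ∙ x ≡ x ∙ r
      NonCommuting x = D∩B x × r ∙ x ≢ x ∙ r

      r² : r ∙ r ≡ ε
      r² = trans (cong (r ∙_) (sym r⁻¹≡r)) (inverseʳ r)

      rr∙ : ∀ x → r ∙ (r ∙ x) ≡ x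
      rr∙ x = trans (sym (assoc r r x)) (trans (cong (_∙ x) r²) (identityˡ x))

      ∙rr : ∀ x → x ∙ r ∙ r ≡ x
      ∙rr x = trans (assoc x r r) (trans (cong (x ∙_) r²) (identityʳ x))

      r∙≢ : ∀ {x} → r ∙ x ≢ x
      r∙≢ {x} eq = r≢ε (∙-cancelʳ x r ε (trans eq (sym (identityˡ x))))

      ∙r≢ : ∀ {x} → x ∙ r ≢ x
      ∙r≢ {x} eq = r≢ε (∙-cancelˡ x r ε (trans eq (sym (identityʳ x))))

      r∙-∈ : ∀ {x} → D∩B x → D∩B (r ∙ x)
      r∙-∈ {x} (e , b) = trans (rep₂-cong (∼⇒≈ (∙∼ x r∈H))) e , ∙-closed B≤ r∈B b

      ⁻¹-∈ : ∀ {x} → D∩B x → D∩B (x ⁻¹)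
      ⁻¹-∈ {x} (e , b) = trans (rep₂-⁻¹ x e) bar≡ , ⁻¹-closed B≤ b

      -- The double coset is its own inverse, so right multiplication by `r` is left multiplication
      -- between two inversions.
      ∙r-∈ : ∀ {x} → D∩B x → D∩B (x ∙ r)
      ∙r-∈ {x} d = subst D∩B (begin
        (r ∙ x ⁻¹) ⁻¹  ≡⟨ ⁻¹-anti-homo-// r x ⟩
        x ∙ r ⁻¹       ≡⟨ cong (x ∙_) r⁻¹≡r ⟩
        x ∙ r          ∎) (⁻¹-∈ (r∙-∈ (⁻¹-∈ d)))

      commuting : ∃ (Enumeration Commuting)
      commuting = enumerate λ x → ((rep₂ x ≟ c) ×-dec B? x) ×-dec (r ∙ x ≟ x ∙ r)

      nonCommuting : ∃ (Enumeration NonCommuting)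
      nonCommuting = enumerate λ x → ((rep₂ x ≟ c) ×-dec B? x) ×-dec ¬? (r ∙ x ≟ x ∙ r)

      4∣nonCommuting : 4 ∣ proj₁ nonCommuting
      4∣nonCommuting = free-square⇒4∣ (proj₂ nonCommuting) (r ∙_) (_∙ r)
        (λ { {x} (d , ≢) → r∙-∈ d , λ eq → ≢ (∙-cancelˡ r _ _ (trans eq (assoc r x r))) })
        (λ { {x} (d , ≢) → ∙r-∈ d , λ eq → ≢ (∙-cancelʳ r _ _ (trans (assoc r x r) eq)) })
        (λ _ → rr∙ _) (λ _ → r∙≢) (λ _ → sym (assoc r _ r)) (λ _ → inj₁ (∙rr _))
        (λ _ → ∙r≢) (λ (_ , ≢) eq → ≢ (sym eq))

      4∣commuting : 4 ∣ proj₁ commuting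
      4∣commuting = free-square⇒4∣ (proj₂ commuting) (r ∙_) _⁻¹
        (λ { {x} (d , eq) → r∙-∈ d , trans (cong (r ∙_) eq) (sym (assoc r x r)) })
        (λ { {x} (d , eq) → ⁻¹-∈ d ,
          trans (⁻¹-left eq) (trans (⁻¹-anti-homo-∙ r x) (cong (x ⁻¹ ∙_) r⁻¹≡r)) })
        (λ _ → rr∙ _) (λ _ → r∙≢) (λ (_ , eq) → ⁻¹-left eq) (λ _ → inj₁ (⁻¹-involutive _))
        -- A fixed point of inversion is excluded by the failed search, and `x ⁻¹ ≡ r ∙ x` would
        -- make `x` a square root of `r`.
        (λ { {x} ((e , b) , _) eq → none (x , e , b , eq) })
        (λ { {x} _ eq → r-nonsquare x (square eq) })
        where
        ⁻¹-left : ∀ {x} → r ∙ x ≡ x ∙ r → r ∙ x ⁻¹ ≡ (r ∙ x) ⁻¹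
        ⁻¹-left {x} eq = begin
          r ∙ x ⁻¹      ≡⟨ cong (_∙ x ⁻¹) r⁻¹≡r ⟨
          r ⁻¹ ∙ x ⁻¹   ≡⟨ ⁻¹-anti-homo-∙ x r ⟨
          (x ∙ r) ⁻¹    ≡⟨ cong _⁻¹ eq ⟨
          (r ∙ x) ⁻¹    ∎
        square : ∀ {x} → x ⁻¹ ≡ r ∙ x → x ∙ x ≡ r
        square {x} eq = begin
          x ∙ x              ≡⟨ rr∙ _ ⟨
          r ∙ (r ∙ (x ∙ x))  ≡⟨ cong (r ∙_) (assoc r x x) ⟨
          r ∙ (r ∙ x ∙ x)    ≡⟨ cong (λ u → r ∙ (u ∙ x)) eq ⟨
          r ∙ (x ⁻¹ ∙ x)     ≡⟨ cong (r ∙_) (inverseˡ x) ⟩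
          r ∙ ε              ≡⟨ identityʳ r ⟩
          r                  ∎

      size≡ : index₂ c ℕ.* k ≡ proj₁ nonCommuting ℕ.+ proj₁ commuting
      size≡ = size-unique sizeD∩B
        (disjointUnion {R = D∩B} (proj₂ nonCommuting) (proj₂ commuting)
          (λ (_ , ≢) (_ , ≡) → ≢ ≡) proj₁ proj₁ split) id id
        where
        split : ∀ {x} → D∩B x → NonCommuting x ⊎ Commuting x
        split {x} d with r ∙ x ≟ x ∙ r
        ... | yes eq = inj₂ (d , eq)
        ... | no  ≢  = inj₁ (d , ≢)

-- The symmetric group of a finite set, encoded by numbers.

funToFin-cong : ∀ {m n} {f g : Fin m → Fin n} → f ≗ g → funToFin f ≡ funToFin g
funToFin-cong {zero}  f≗g = refl
funToFin-cong {suc m} f≗g = cong₂ combine (f≗g zero) (funToFin-cong (f≗g ∘ suc))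

finToFun-injective : ∀ {m n} {i j : Fin (n ^ m)} → finToFun {n} {m} i ≗ finToFun j → i ≡ j
finToFun-injective {m} {n} {i} {j} eq =
  trans (sym (Fin.funToFin-finToFin {m} {n} i)) (trans (funToFin-cong eq) (Fin.funToFin-finToFin {m} j))

module _ {V : Set} where

  ⁻¹ₚ-cong : (σ τ : Perm V) → σ ≈ₚ τ → (σ ⁻¹ₚ) ≈ₚ (τ ⁻¹ₚ)
  ⁻¹ₚ-cong σ τ eq v = begin
    from σ v                  ≡⟨ cong (from σ) (to∘from τ v) ⟨
    from σ (to τ (from τ v))  ≡⟨ cong (from σ) (eq (from τ v)) ⟨
    from σ (to σ (from τ v))  ≡⟨ from∘to σ (from τ v) ⟩
    from τ v                  ∎
    where open ≡-Reasoning

  record IsPermSubgroup (H : Perm V → Set) : Set where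
    field
      respects   : RespectsEq H
      ·-closed   : ∀ {σ τ} → H σ → H τ → H (σ · τ)
      id-closed  : H idₚ
      ⁻¹ₚ-closed : ∀ {σ} → H σ → H (σ ⁻¹ₚ)

module SymmetricGroup {V : Set} {N : ℕ} (E : Enumeration {V} (λ _ → ⊤) N) where

  private
    _on_ : Fin (N ^ N) → Fin N → Fin N
    _on_ = finToFun

    -- A number below `N ^ N` encodes a self-map of `Fin N`; the codes of bijections form the group.
    IsInvertible : Fin (N ^ N) → Set
    IsInvertible i = ∃ λ j → (∀ k → i on (j on k) ≡ k) × (∀ k → j on (i on k) ≡ k)

    invertible? : Decidable IsInvertible
    invertible? i = any? λ j → all? (λ k → i on (j on k) ≟ k) ×-dec all? (λ k → j on (i on k) ≟ k)

    invertibles : Enumeration IsInvertible (proj₁ (enumerate invertible?))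
    invertibles = proj₂ (enumerate invertible?)

    label : V → Fin N
    label v = index E {v} tt

    label-elem : ∀ k → label (elem E k) ≡ k
    label-elem k = elem-injective E (elem-index E tt)

    code′ : (V → V) → Fin (N ^ N)
    code′ f = funToFin (label ∘ f ∘ elem E)

    code′-on : ∀ f k → code′ f on k ≡ label (f (elem E k))
    code′-on f = Fin.finToFun-funToFin (label ∘ f ∘ elem E)

    code′-inverse : ∀ {f g} → (∀ v → f (g v) ≡ v) → ∀ k → code′ f on (code′ g on k) ≡ k
    code′-inverse {f} {g} fg k = begin
      code′ f on (code′ g on k)                   ≡⟨ cong (code′ f on_) (code′-on g k) ⟩
      code′ f on label (g (elem E k))             ≡⟨ code′-on f _ ⟩
      label (f (elem E (label (g (elem E k)))))   ≡⟨ cong (label ∘ f) (elem-index E tt) ⟩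
      label (f (g (elem E k)))                    ≡⟨ cong label (fg (elem E k)) ⟩
      label (elem E k)                            ≡⟨ label-elem k ⟩
      k                                           ∎
      where open ≡-Reasoning

    codeInvertible : ∀ σ → IsInvertible (code′ (to σ))
    codeInvertible σ = code′ (from σ) , code′-inverse {to σ} {from σ} (to∘from σ)
                                      , code′-inverse {from σ} {to σ} (from∘to σ)

    perm-inverse : ∀ {i j} → (∀ k → i on (j on k) ≡ k) →
                   ∀ v → elem E (i on label (elem E (j on label v))) ≡ v
    perm-inverse {i} {j} ij v =
      trans (cong (λ k → elem E (i on k)) (label-elem _))
            (trans (cong (elem E) (ij (label v))) (elem-index E tt))

  abstract
    order : ℕ
    order = proj₁ (enumerate invertible?)

    -- Under this encoding `≈ₚ` becomes propositional equality, which is decidable, as the results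
    -- on finite groups require.
    perm : Fin order → Perm V
    perm x = record
      { to      = λ v → elem E (elem invertibles x on label v)
      ; from    = λ v → elem E (proj₁ (elem-∈ invertibles x) on label v)
      ; to∘from = perm-inverse (proj₁ (proj₂ (elem-∈ invertibles x)))
      ; from∘to = perm-inverse (proj₂ (proj₂ (elem-∈ invertibles x)))
      }

    code : Perm V → Fin order
    code σ = index invertibles (codeInvertible σ)

    perm-code : ∀ σ → perm (code σ) ≈ₚ σ
    perm-code σ v = begin
      elem E (elem invertibles (code σ) on label v)  ≡⟨ cong (λ i → elem E (i on label v))
                                                          (elem-index invertibles (codeInvertible σ)) ⟩
      elem E (code′ (to σ) on label v)               ≡⟨ cong (elem E) (code′-on (to σ) (label v)) ⟩
      elem E (label (to σ (elem E (label v))))       ≡⟨ elem-index E tt ⟩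
      to σ (elem E (label v))                        ≡⟨ cong (to σ) (elem-index E tt) ⟩
      to σ v                                         ∎
      where open ≡-Reasoning

    perm-injective : ∀ {x y} → perm x ≈ₚ perm y → x ≡ y
    perm-injective {x} {y} eq = elem-injective invertibles (finToFun-injective λ k → begin
      elem invertibles x on k                   ≡⟨ cong (elem invertibles x on_) (label-elem k) ⟨
      elem invertibles x on label (elem E k)    ≡⟨ elem-injective E (eq (elem E k)) ⟩
      elem invertibles y on label (elem E k)    ≡⟨ cong (elem invertibles y on_) (label-elem k) ⟩
      elem invertibles y on k                   ∎)
      where open ≡-Reasoning

  code-cong : ∀ σ τ → σ ≈ₚ τ → code σ ≡ code τ
  code-cong σ τ eq = perm-injective λ v →
    trans (perm-code σ v) (trans (eq v) (sym (perm-code τ v)))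

  code-injective : ∀ σ τ → code σ ≡ code τ → σ ≈ₚ τ
  code-injective σ τ eq v = begin
    to σ v                ≡⟨ perm-code σ v ⟨
    to (perm (code σ)) v  ≡⟨ cong (λ x → to (perm x) v) eq ⟩
    to (perm (code τ)) v  ≡⟨ perm-code τ v ⟩
    to τ v                ∎
    where open ≡-Reasoning

  code-perm : ∀ x → code (perm x) ≡ x
  code-perm x = perm-injective (perm-code (perm x))

  mul : Fin order → Fin order → Fin order
  mul x y = code (perm x · perm y)

  unit : Fin order
  unit = code idₚ

  inv : Fin order → Fin order
  inv x = code (perm x ⁻¹ₚ)

  code-· : ∀ σ τ → mul (code σ) (code τ) ≡ code (σ · τ)
  code-· σ τ = code-cong (perm (code σ) · perm (code τ)) (σ · τ) λ v →
    trans (cong (to (perm (code σ))) (perm-code τ v)) (perm-code σ (to τ v))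

  code-⁻¹ : ∀ σ → inv (code σ) ≡ code (σ ⁻¹ₚ)
  code-⁻¹ σ = code-cong (perm (code σ) ⁻¹ₚ) (σ ⁻¹ₚ) (⁻¹ₚ-cong (perm (code σ)) σ (perm-code σ))

  isGroup : IsGroup _≡_ mul unit inv
  isGroup = record
    { isMonoid = record
      { isSemigroup = record
        { isMagma = record { isEquivalence = isEquivalence ; ∙-cong = cong₂ mul }
        ; assoc   = λ x y z → begin
            mul (mul x y) z                        ≡⟨ cong (mul (mul x y)) (code-perm z) ⟨
            mul (mul x y) (code (perm z))          ≡⟨ code-· (perm x · perm y) (perm z) ⟩
            code ((perm x · perm y) · perm z)      ≡⟨ code-cong ((perm x · perm y) · perm z)
                                                          (perm x · (perm y · perm z)) (λ _ → refl) ⟩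
            code (perm x · (perm y · perm z))      ≡⟨ code-· (perm x) (perm y · perm z) ⟨
            mul (code (perm x)) (mul y z)          ≡⟨ cong (λ u → mul u (mul y z)) (code-perm x) ⟩
            mul x (mul y z)                        ∎
        }
      ; identity = (λ x → begin
            mul unit x                ≡⟨ cong (mul unit) (code-perm x) ⟨
            mul unit (code (perm x))  ≡⟨ code-· idₚ (perm x) ⟩
            code (idₚ · perm x)       ≡⟨ code-cong (idₚ · perm x) (perm x) (λ _ → refl) ⟩
            code (perm x)             ≡⟨ code-perm x ⟩
            x                         ∎)
        , (λ x → begin
            mul x unit                ≡⟨ cong (λ u → mul u unit) (code-perm x) ⟨
            mul (code (perm x)) unit  ≡⟨ code-· (perm x) idₚ ⟩
            code (perm x · idₚ)       ≡⟨ code-cong (perm x · idₚ) (perm x) (λ _ → refl) ⟩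
            code (perm x)             ≡⟨ code-perm x ⟩
            x                         ∎)
      }
    ; inverse = (λ x → begin
          mul (inv x) x                ≡⟨ cong (mul (inv x)) (code-perm x) ⟨
          mul (inv x) (code (perm x))  ≡⟨ code-· (perm x ⁻¹ₚ) (perm x) ⟩
          code ((perm x ⁻¹ₚ) · perm x)   ≡⟨ code-cong ((perm x ⁻¹ₚ) · perm x) idₚ (from∘to (perm x)) ⟩
          unit                         ∎)
      , (λ x → begin
          mul x (inv x)                ≡⟨ cong (λ u → mul u (inv x)) (code-perm x) ⟨
          mul (code (perm x)) (inv x)  ≡⟨ code-· (perm x) (perm x ⁻¹ₚ) ⟩
          code (perm x · (perm x ⁻¹ₚ))   ≡⟨ code-cong (perm x · (perm x ⁻¹ₚ)) idₚ (to∘from (perm x)) ⟩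
          unit                         ∎)
    ; ⁻¹-cong = cong inv
    }
    where open ≡-Reasoning

  open FiniteGroup isGroup

  module _ {P : Perm V → Set} (P≤ : IsPermSubgroup P) where
    open IsPermSubgroup P≤ using (respects)

    encode : ∀ σ → P σ → P (perm (code σ))
    encode σ = respects {σ} {perm (code σ)} λ v → sym (perm-code σ v)

    decode : ∀ σ → P (perm (code σ)) → P σ
    decode σ = respects {perm (code σ)} {σ} (perm-code σ)

  isSubgroup : ∀ {H} → IsPermSubgroup H → IsSubgroup (H ∘ perm)
  isSubgroup {H} H≤ = record
    { ∙-closed  = λ {x} {y} p q → encode H≤ (perm x · perm y) (·-closed {perm x} {perm y} p q)
    ; ε-closed  = encode H≤ idₚ id-closed
    ; ⁻¹-closed = λ {x} p → encode H≤ (perm x ⁻¹ₚ) (⁻¹ₚ-closed {perm x} p)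
    }
    where open IsPermSubgroup H≤

  module _ {H B : Perm V → Set} (H? : Decidable (H ∘ perm)) (B? : Decidable (B ∘ perm))
           (H≤ : IsPermSubgroup H) (B≤ : IsPermSubgroup B)
           (G≡HB : ∀ σ → ∃ λ τ → B τ × H (τ · (σ ⁻¹ₚ)))
           {k} (H∩B : Enumeration (λ x → H (perm x) × B (perm x)) k) (4∤k : ¬ 4 ∣ k)
           {ρ} (ρ∈H : H ρ) (ρ∈B : B ρ) (ρ⁻¹≈ρ : (ρ ⁻¹ₚ) ≈ₚ ρ) (ρ≉id : ¬ (ρ ≈ₚ idₚ))
           (ρ-nonsquare : ∀ σ → ¬ ((σ · σ) ≈ₚ ρ)) where

    open IsPermSubgroup H≤

    private
      factorise : ∀ x → ∃ λ t → B (perm t) × H (perm (mul t (inv x)))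
      factorise x with τ , τ∈B , τx⁻¹∈H ← G≡HB (perm x) =
        code τ , encode B≤ τ τ∈B ,
        subst (H ∘ perm) (sym (code-· τ (perm x ⁻¹ₚ))) (encode H≤ (τ · (perm x ⁻¹ₚ)) τx⁻¹∈H)

    open Cosets H? (isSubgroup H≤)
    open Transversal (involutionCondition H? B? (isSubgroup H≤) (isSubgroup B≤) factorise
      H∩B 4∤k (encode H≤ ρ ρ∈H) (encode B≤ ρ ρ∈B)
      (trans (code-⁻¹ ρ) (code-cong (ρ ⁻¹ₚ) ρ ρ⁻¹≈ρ)) (ρ≉id ∘ code-injective ρ idₚ)
      (λ x eq → ρ-nonsquare (perm x) (code-injective (perm x · perm x) ρ eq)))

    isPerfectCode : IsPerfectCodeOfGroup H
    isPerfectCode = S , (S-respects , S-nontrivial , S-⁻¹) , independent ,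
      λ g g∉H → exists g g∉H , unique g
      where
      S : Perm V → Set
      S σ = Connection (code σ)

      S-respects : RespectsEq S
      S-respects {σ} {τ} eq = subst Connection (code-cong σ τ eq)

      S∩H : ∀ σ → S σ → ¬ H σ
      S∩H σ σ∈S σ∈H = proj₁ σ∈S (encode H≤ σ σ∈H)

      S-nontrivial : ∀ σ → S σ → ¬ (σ ≈ₚ idₚ)
      S-nontrivial σ σ∈S eq = S∩H σ σ∈S (respects {idₚ} {σ} (λ v → sym (eq v)) id-closed)

      S-⁻¹ : ∀ σ → S σ → S (σ ⁻¹ₚ)
      S-⁻¹ σ σ∈S = subst Connection (code-⁻¹ σ) (Connection-⁻¹ σ∈S)

      independent : ∀ c c′ → H c → H c′ → ¬ Adj S c c′
      -- An edge between `c` and `c′` would put `s = c′ · (c ⁻¹ₚ)` in `H`.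
      independent c c′ c∈H c′∈H (s , s∈S , eq) = S∩H s s∈S
        (respects {c′ · (c ⁻¹ₚ)} {s}
          (λ v → trans (eq (from c v)) (cong (to s) (to∘from c v)))
          (·-closed {c′} {c ⁻¹ₚ} c′∈H (⁻¹ₚ-closed {c} c∈H)))

      exists : ∀ g → ¬ H g → ∃ λ c → H c × Adj S g c
      exists g g∉H with z , z∈S , zg∈H ← Connection-exists (g∉H ∘ decode H≤ g) =
        perm z · g ,
        decode H≤ (perm z · g) (subst (H ∘ perm)
          (trans (cong (λ u → mul u (code g)) (sym (code-perm z))) (code-· (perm z) g)) zg∈H) ,
        perm z , subst Connection (sym (code-perm z)) z∈S , λ _ → refl

      -- `s` and `s′` both carry `g` into `H`, so they share a right coset, which contains only one
      -- connection.
      unique : ∀ g c c′ → H c → H c′ → Adj S g c → Adj S g c′ → c ≈ₚ c′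
      unique g c c′ c∈H c′∈H (s , s∈S , eq) (s′ , s′∈S , eq′) v = begin
        to c v           ≡⟨ eq v ⟩
        to s (to g v)    ≡⟨ code-injective s s′ (Connection-unique s∈S s′∈S
                              (toH s c c∈H eq) (toH s′ c′ c′∈H eq′)) (to g v) ⟩
        to s′ (to g v)   ≡⟨ eq′ v ⟨
        to c′ v          ∎
        where
        open ≡-Reasoning
        toH : ∀ s c → H c → c ≈ₚ (s · g) → H (perm (mul (code s) (code g)))
        toH s c c∈H eq = subst (H ∘ perm) (sym (code-· s g))
          (encode H≤ (s · g) (respects {c} {s · g} eq c∈H))

-- The affine group of the plane over a finite field.

module AffinePlane {q : ℕ} (F : FiniteField q) where

  open FiniteField F using (isCommutativeRing; 0≢1; inverse)

  ring : CommutativeRing _ _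
  ring = record { isCommutativeRing = isCommutativeRing }

  open CommutativeRing ring
    using (_+_; _*_; -_; 0#; 1#; +-comm; +-assoc; +-identityˡ; +-identityʳ; -‿inverseˡ; -‿inverseʳ
          ; *-identityˡ; *-identityʳ; zeroˡ; zeroʳ; *-comm; *-assoc)
    renaming (Carrier to K)
  open RingProperties (CommutativeRing.ring ring)
    using (-‿distribˡ-*; -‿distribʳ-*; -0#≈0#; +-cancelʳ; -‿involutive; -1*x≈-x)
    renaming (x∙y⁻¹≈ε⇒x≈y to x-y≡0⇒x≡y)
  open Solver (CommutativeRing.commutativeSemiring ring) using (solve; _:+_; _:*_; _:=_; con)
  open ≡-Reasoning

  V : Set
  V = Vec2 F

  origin e₁ e₂ : V
  origin = 0# , 0#
  e₁     = 1# , 0#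
  e₂     = 0# , 1#

  IsAffine : Perm V → Set
  IsAffine σ = ∃[ a ] ∃[ b ] ∃[ c ] ∃[ d ] ∃[ u ] ∃[ v ]
    (∀ x y → to σ (x , y) ≡ (a * x + b * y + u , c * x + d * y + v))

  to-injective : ∀ (σ : Perm V) {v w} → to σ v ≡ to σ w → v ≡ w
  to-injective σ {v} {w} eq = trans (sym (from∘to σ v)) (trans (cong (from σ) eq) (from∘to σ w))

  ad-bc : ∀ a b c d → a * d + - (b * c) ≡ a * d + b * - c
  ad-bc a b c d = cong (a * d +_) (-‿distribʳ-* b c)

  abstract
    -- If the determinant vanished, the columns `(d , - c)` and `(- b , a)` of the adjugate matrix
    -- would lie in the kernel, which is trivial as `σ` is injective. Then `a` and `c` vanish and
    -- `e₁` is in the kernel, a contradiction. This spares determinant computations for products and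
    -- inverses.
    affine⇒AGL₂ : ∀ σ → IsAffine σ → IsAGL2 F σ
    affine⇒AGL₂ σ (a , b , c , d , u , v , σ≡) = a , b , c , d , u , v , det≢0 , σ≡
      where
      collapse : ∀ {x y} → a * x + b * y ≡ 0# → c * x + d * y ≡ 0# → (x , y) ≡ origin
      collapse {x} {y} eq₁ eq₂ = to-injective σ (begin
        to σ (x , y)                               ≡⟨ σ≡ x y ⟩
        a * x + b * y + u , c * x + d * y + v      ≡⟨ cong₂ (λ s t → s + u , t + v) eq₁ eq₂ ⟩
        0# + u , 0# + v                            ≡⟨ cong₂ (λ s t → s + u , t + v) (zero-row a b) (zero-row c d) ⟨
        a * 0# + b * 0# + u , c * 0# + d * 0# + v  ≡⟨ σ≡ 0# 0# ⟨
        to σ origin                                ∎)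
        where
        zero-row : ∀ s t → s * 0# + t * 0# ≡ 0#
        zero-row s t = trans (cong₂ _+_ (zeroʳ s) (zeroʳ t)) (+-identityˡ 0#)

      cancel : ∀ s t → s * - t + t * s ≡ 0#
      cancel s t = begin
        s * - t + t * s      ≡⟨ cong₂ _+_ (sym (-‿distribʳ-* s t)) (*-comm t s) ⟩
        - (s * t) + s * t    ≡⟨ -‿inverseˡ (s * t) ⟩
        0#                   ∎

      -≡0 : ∀ {x} → - x ≡ 0# → x ≡ 0#
      -≡0 {x} eq = trans (sym (-‿involutive x)) (trans (cong -_ eq) -0#≈0#)

      det≢0 : a * d + - (b * c) ≢ 0#
      det≢0 det≡0 = 0≢1 (sym (cong proj₁ (collapse {1#} {0#}
          (first-column a b (cong proj₂ row₂)) (first-column c d (-≡0 (cong proj₂ row₁))))))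
        where
        row₁ : (d , - c) ≡ origin
        row₁ = collapse (trans (sym (ad-bc a b c d)) det≡0)
                        (trans (+-comm _ _) (cancel d c))
        row₂ : (- b , a) ≡ origin
        row₂ = collapse (cancel a b) (trans (+-comm _ _) (trans
          (cong₂ _+_ (*-comm d a) (trans (sym (-‿distribʳ-* c b)) (cong -_ (*-comm c b)))) det≡0))
        first-column : ∀ s t → s ≡ 0# → s * 1# + t * 0# ≡ 0#
        first-column s t refl = trans (cong₂ _+_ (*-identityʳ 0#) (zeroʳ t)) (+-identityˡ 0#)

  module _ (a b c d δ : K) (det*δ≡1 : (a * d + - (b * c)) * δ ≡ 1#) where

    private
      collect : ∀ s t m x y → (s + t) * δ ≡ 1# → m ≡ 0# → (s + t) * δ * x + δ * m * y ≡ x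
      collect s t _ x y eq refl = begin
        (s + t) * δ * x + δ * 0# * y  ≡⟨ cong₂ (λ i j → i * x + j * y) eq (zeroʳ δ) ⟩
        1# * x + 0# * y               ≡⟨ cong₂ _+_ (*-identityˡ x) (zeroˡ y) ⟩
        x + 0#                        ≡⟨ +-identityʳ x ⟩
        x                             ∎

      ad+bc′ : (a * d + b * - c) * δ ≡ 1#
      ad+bc′ = trans (cong (_* δ) (sym (ad-bc a b c d))) det*δ≡1

      ad+b′c : (a * d + - b * c) * δ ≡ 1#
      ad+b′c = trans (cong (λ i → (a * d + i) * δ) (sym (-‿distribˡ-* b c))) det*δ≡1

      cancel′ : ∀ s t → s * t + s * - t ≡ 0#
      cancel′ s t = trans (cong (s * t +_) (sym (-‿distribʳ-* s t))) (-‿inverseʳ (s * t))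

    linear : Perm V
    linear = record
      { to      = λ (x , y) → a * x + b * y , c * x + d * y
      -- The inverse matrix is the adjugate times the inverse `δ` of the determinant. The solver
      -- handles semirings, so `- b` and `- c` enter it as independent variables, and `collect`
      -- restores their meaning.
      ; from    = λ (x , y) → δ * d * x + δ * - b * y , δ * - c * x + δ * a * y
      ; to∘from = λ (x , y) → cong₂ _,_
          (trans (solve 8 (λ a b d δ b′ c′ x y →
                    a :* (δ :* d :* x :+ δ :* b′ :* y) :+ b :* (δ :* c′ :* x :+ δ :* a :* y) :=
                    (a :* d :+ b :* c′) :* δ :* x :+ δ :* (a :* b :+ a :* b′) :* y)
                  refl a b d δ (- b) (- c) x y)
                 (collect _ _ _ x y ad+bc′ (cancel′ a b)))
          (trans (solve 8 (λ a c d δ b′ c′ x y →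
                    c :* (δ :* d :* x :+ δ :* b′ :* y) :+ d :* (δ :* c′ :* x :+ δ :* a :* y) :=
                    (a :* d :+ b′ :* c) :* δ :* y :+ δ :* (d :* c :+ d :* c′) :* x)
                  refl a c d δ (- b) (- c) x y)
                 (collect _ _ _ y x ad+b′c (cancel′ d c)))
      ; from∘to = λ (x , y) → cong₂ _,_
          (trans (solve 8 (λ a b c d δ b′ x y →
                    δ :* d :* (a :* x :+ b :* y) :+ δ :* b′ :* (c :* x :+ d :* y) :=
                    (a :* d :+ b′ :* c) :* δ :* x :+ δ :* (d :* b :+ d :* b′) :* y)
                  refl a b c d δ (- b) x y)
                 (collect _ _ _ x y ad+b′c (cancel′ d b)))
          (trans (solve 8 (λ a b c d δ c′ x y →
                    δ :* c′ :* (a :* x :+ b :* y) :+ δ :* a :* (c :* x :+ d :* y) :=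
                    (a :* d :+ b :* c′) :* δ :* y :+ δ :* (a :* c :+ a :* c′) :* x)
                  refl a b c d δ (- c) x y)
                 (collect _ _ _ y x ad+bc′ (cancel′ a c)))
      }

  +-undo : ∀ x {s t} → s + t ≡ 0# → x + s + t ≡ x
  +-undo x eq = trans (+-assoc x _ _) (trans (cong (x +_) eq) (+-identityʳ x))

  translation : K → K → Perm V
  translation u v = record
    { to      = λ (x , y) → x + u , y + v
    ; from    = λ (x , y) → x + - u , y + - v
    ; to∘from = λ (x , y) → cong₂ _,_ (+-undo x (-‿inverseˡ u)) (+-undo y (-‿inverseˡ v))
    ; from∘to = λ (x , y) → cong₂ _,_ (+-undo x (-‿inverseʳ u)) (+-undo y (-‿inverseʳ v))
    }

  isPermSubgroup : IsPermSubgroup (IsAGL2 F)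
  isPermSubgroup = record
    { respects   = λ { eq (a , b , c , d , u , v , det≢0 , σ≡) →
        a , b , c , d , u , v , det≢0 , λ x y → trans (sym (eq (x , y))) (σ≡ x y) }
    ; ·-closed   = λ {σ} {τ} → ·-closed {σ} {τ}
    ; id-closed  = affine⇒AGL₂ idₚ (1# , 0# , 0# , 1# , 0# , 0# , λ x y → cong₂ _,_
        (solve 2 (λ x y → x := con 1 :* x :+ con 0 :* y :+ con 0) refl x y)
        (solve 2 (λ x y → y := con 0 :* x :+ con 1 :* y :+ con 0) refl x y))
    ; ⁻¹ₚ-closed = λ {σ} → ⁻¹ₚ-closed {σ}
    }
    where
    ·-closed : ∀ {σ τ} → IsAGL2 F σ → IsAGL2 F τ → IsAGL2 F (σ · τ)
    ·-closed {σ} {τ} (a , b , c , d , u , v , _ , σ≡) (a′ , b′ , c′ , d′ , u′ , v′ , _ , τ≡) =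
      affine⇒AGL₂ (σ · τ) (_ , _ , _ , _ , _ , _ , λ x y →
        trans (cong (to σ) (τ≡ x y)) (trans (σ≡ _ _)
          (cong₂ _,_ (row a b u x y) (row c d v x y))))
      where
      row : ∀ s t w x y → s * (a′ * x + b′ * y + u′) + t * (c′ * x + d′ * y + v′) + w ≡
                          (s * a′ + t * c′) * x + (s * b′ + t * d′) * y + (s * u′ + t * v′ + w)
      row s t w x y = solve 11 (λ s t w x y a b u c d v →
        s :* (a :* x :+ b :* y :+ u) :+ t :* (c :* x :+ d :* y :+ v) :+ w :=
        (s :* a :+ t :* c) :* x :+ (s :* b :+ t :* d) :* y :+ (s :* u :+ t :* v :+ w))
        refl s t w x y a′ b′ u′ c′ d′ v′

    ⁻¹ₚ-closed : ∀ {σ} → IsAGL2 F σ → IsAGL2 F (σ ⁻¹ₚ)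
    ⁻¹ₚ-closed {σ} (a , b , c , d , u , v , det≢0 , σ≡) =
      affine⇒AGL₂ (σ ⁻¹ₚ) (_ , _ , _ , _ , _ , _ , λ x y →
        -- Pointwise equal permutations have pointwise equal inverses, so `from σ` is read off from
        -- the explicit inverse of `T · L`.
        trans (⁻¹ₚ-cong σ (T · L) (λ (x , y) → σ≡ x y) (x , y))
              (cong₂ _,_ (row (δ * d) (δ * - b) x y) (row (δ * - c) (δ * a) x y)))
      where
      δ : K
      δ = proj₁ (inverse _ det≢0)
      L T : Perm V
      L = linear a b c d δ (proj₂ (inverse _ det≢0))
      T = translation u v
      row : ∀ s t x y → s * (x + - u) + t * (y + - v) ≡ s * x + t * y + (s * - u + t * - v)
      row s t x y = solve 6 (λ s t x y u v →
        s :* (x :+ u) :+ t :* (y :+ v) := s :* x :+ t :* y :+ (s :* u :+ t :* v))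
        refl s t x y (- u) (- v)

  isAGL₂? : ∀ σ → Dec (IsAGL2 F σ)
  isAGL₂? σ = any? λ a → any? λ b → any? λ c → any? λ d → any? λ u → any? λ v →
    ¬? (_ ≟ _) ×-dec all? λ x → all? λ y → ≡-dec _≟_ _≟_ _ _

  linear-AGL₂ : ∀ a b c d δ eq → IsAGL2 F (linear a b c d δ eq)
  linear-AGL₂ a b c d δ eq = affine⇒AGL₂ (linear a b c d δ eq)
    (a , b , c , d , 0# , 0# , λ x y → cong₂ _,_ (sym (+-identityʳ _)) (sym (+-identityʳ _)))

  translation-AGL₂ : ∀ u v → IsAGL2 F (translation u v)
  translation-AGL₂ u v = affine⇒AGL₂ (translation u v) (1# , 0# , 0# , 1# , u , v , λ x y → cong₂ _,_
    (solve 3 (λ x y u → x :+ u := con 1 :* x :+ con 0 :* y :+ u) refl x y u)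
    (solve 3 (λ x y v → y :+ v := con 0 :* x :+ con 1 :* y :+ v) refl x y v))

  -- The subgroup `B`, taken in the full symmetric group.
  FixesFrame : Perm V → Set
  FixesFrame σ = to σ origin ≡ origin × to σ e₁ ≡ e₁

  fixesFrame? : ∀ σ → Dec (FixesFrame σ)
  fixesFrame? σ = ≡-dec _≟_ _≟_ _ _ ×-dec ≡-dec _≟_ _≟_ _ _

  fixesFrame-isPermSubgroup : IsPermSubgroup FixesFrame
  fixesFrame-isPermSubgroup = record
    { respects   = λ eq (p , r) → trans (sym (eq origin)) p , trans (sym (eq e₁)) r
    ; ·-closed   = λ {σ} (p , r) (p′ , r′) → trans (cong (to σ) p′) p , trans (cong (to σ) r′) r
    ; id-closed  = refl , refl
    ; ⁻¹ₚ-closed = λ {σ} (p , r) → trans (cong (from σ) (sym p)) (from∘to σ origin)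
                                 , trans (cong (from σ) (sym r)) (from∘to σ e₁)
    }

  withColumns : ∀ a c b d δ → (a * d + - (b * c)) * δ ≡ 1# →
                ∃ λ σ → IsAGL2 F σ × to σ origin ≡ origin × to σ e₁ ≡ (a , c)
  withColumns a c b d δ eq = linear a b c d δ eq , linear-AGL₂ a b c d δ eq
    , cong₂ _,_ (at-0 a b) (at-0 c d) , cong₂ _,_ (at-1 a b) (at-1 c d)
    where
    at-0 : ∀ s t → s * 0# + t * 0# ≡ 0#
    at-0 = solve 2 (λ s t → s :* con 0 :+ t :* con 0 := con 0) refl
    at-1 : ∀ s t → s * 1# + t * 0# ≡ s
    at-1 = solve 2 (λ s t → s :* con 1 :+ t :* con 0 := s) refl

  module _ (s t : K) where

    column≢0ˡ : s ≢ 0# → ∃ λ σ → IsAGL2 F σ × to σ origin ≡ origin × to σ e₁ ≡ (s , t)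
    -- The second column `(0# , 1#)` gives determinant `s`.
    column≢0ˡ s≢0 = withColumns s t 0# 1# δ (begin
      (s * 1# + - (0# * t)) * δ  ≡⟨ cong (λ i → (s * 1# + i) * δ) (trans (cong -_ (zeroˡ t)) -0#≈0#) ⟩
      (s * 1# + 0#) * δ          ≡⟨ cong (_* δ) (trans (+-identityʳ _) (*-identityʳ s)) ⟩
      s * δ                      ≡⟨ proj₂ (inverse s s≢0) ⟩
      1#                         ∎)
      where
      δ : K
      δ = proj₁ (inverse s s≢0)

    column≢0ʳ : t ≢ 0# → ∃ λ σ → IsAGL2 F σ × to σ origin ≡ origin × to σ e₁ ≡ (s , t)
    -- The second column `(- 1# , 0#)` gives determinant `t`.
    column≢0ʳ t≢0 = withColumns s t (- 1#) 0# δ (begin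
      (s * 0# + - (- 1# * t)) * δ   ≡⟨ cong (λ i → (i + - (- 1# * t)) * δ) (zeroʳ s) ⟩
      (0# + - (- 1# * t)) * δ       ≡⟨ cong (_* δ) (+-identityˡ _) ⟩
      - (- 1# * t) * δ              ≡⟨ cong (λ i → - i * δ) (-1*x≈-x t) ⟩
      - - t * δ                     ≡⟨ cong (_* δ) (-‿involutive t) ⟩
      t * δ                         ≡⟨ proj₂ (inverse t t≢0) ⟩
      1#                            ∎)
      where
      δ : K
      δ = proj₁ (inverse t t≢0)

    linear-to : (s , t) ≢ origin → ∃ λ σ → IsAGL2 F σ × to σ origin ≡ origin × to σ e₁ ≡ (s , t)
    linear-to w≢0 with s ≟ 0#
    ... | no s≢0  = column≢0ˡ s≢0
    ... | yes s≡0 = column≢0ʳ (λ t≡0 → w≢0 (cong₂ _,_ s≡0 t≡0))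

  -- The inverse is built first: a linear map taking `e₁` to the difference `w - v`, followed by the
  -- translation by `v`.
  two-transitive : ∀ v w → v ≢ w → ∃ λ σ → IsAGL2 F σ × to σ v ≡ origin × to σ w ≡ e₁
  two-transitive (x , y) (x′ , y′) v≢w
    with L , L∈ , L0 , Le₁ ← linear-to (x′ + - x) (y′ + - y)
      (λ eq → v≢w (cong₂ _,_ (sym (x-y≡0⇒x≡y x′ x (cong proj₁ eq)))
                             (sym (x-y≡0⇒x≡y y′ y (cong proj₂ eq)))))
    = A ⁻¹ₚ , ⁻¹ₚ-closed {A} (·-closed {T} {L} (translation-AGL₂ x y) L∈)
    , trans (cong (from A) (sym A0)) (from∘to A origin)
    , trans (cong (from A) (sym Ae₁)) (from∘to A e₁)
    where
    open IsPermSubgroup isPermSubgroup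
    T A : Perm V
    T = translation x y
    A = T · L
    A0 : to A origin ≡ (x , y)
    A0 = trans (cong (to T) L0) (cong₂ _,_ (+-identityˡ x) (+-identityˡ y))
    Ae₁ : to A e₁ ≡ (x′ , y′)
    Ae₁ = trans (cong (to T) Le₁) (cong₂ _,_ (+-undo x′ (-‿inverseˡ x)) (+-undo y′ (-‿inverseˡ y)))

  -- These maps make up `H ∩ B`: their matrices have first column `e₁` and second column `(b , d)`.
  shear : (b d : K) → d ≢ 0# → Perm V
  shear b d d≢0 = record
    { to      = λ (x , y) → x + b * y , d * y
    ; from    = λ (x , y) → x + - (b * (δ * y)) , δ * y
    ; to∘from = λ (x , y) → cong₂ _,_ (+-undo x (-‿inverseˡ _)) (unscale dδ≡1 y)
    ; from∘to = λ (x , y) → cong₂ _,_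
        (+-undo x (trans (cong (λ i → b * y + - (b * i)) (unscale δd≡1 y)) (-‿inverseʳ _)))
        (unscale δd≡1 y)
    }
    where
    δ : K
    δ = proj₁ (inverse d d≢0)
    dδ≡1 : d * δ ≡ 1#
    dδ≡1 = proj₂ (inverse d d≢0)
    δd≡1 : δ * d ≡ 1#
    δd≡1 = trans (*-comm δ d) dδ≡1
    unscale : ∀ {s t} → s * t ≡ 1# → ∀ y → s * (t * y) ≡ y
    unscale eq y = trans (sym (*-assoc _ _ y)) (trans (cong (_* y) eq) (*-identityˡ y))

  module _ (b d : K) (d≢0 : d ≢ 0#) where

    shear-AGL₂ : IsAGL2 F (shear b d d≢0)
    shear-AGL₂ = affine⇒AGL₂ (shear b d d≢0) (1# , b , 0# , d , 0# , 0# , λ x y → cong₂ _,_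
      (solve 3 (λ b x y → x :+ b :* y := con 1 :* x :+ b :* y :+ con 0) refl b x y)
      (solve 3 (λ d x y → d :* y := con 0 :* x :+ d :* y :+ con 0) refl d x y))

    shear-fixesFrame : FixesFrame (shear b d d≢0)
    shear-fixesFrame = cong₂ _,_ (x+b0≡x 0#) (zeroʳ d) , cong₂ _,_ (x+b0≡x 1#) (zeroʳ d)
      where
      x+b0≡x : ∀ x → x + b * 0# ≡ x
      x+b0≡x x = trans (cong (x +_) (zeroʳ b)) (+-identityʳ x)

    shear-e₂ : to (shear b d d≢0) e₂ ≡ (b , d)
    shear-e₂ = cong₂ _,_ (trans (+-identityˡ _) (*-identityʳ b)) (*-identityʳ d)

  abstract
    -- The value at the origin is the translation part and the value at `e₁` then gives the first
    -- column, so the image of `e₂` determines `σ`.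
    fixesFrame⇒shear : ∀ σ → IsAGL2 F σ → FixesFrame σ → ∃ λ b → ∃ λ d →
      d ≢ 0# × to σ e₂ ≡ (b , d) × (∀ x y → to σ (x , y) ≡ (x + b * y , d * y))
    fixesFrame⇒shear σ (a , b , c , d , u , v , det≢0 , σ≡) (σ0 , σ1) =
      b , d , d≢0 , trans (shape 0# 1#) (shear-e₂ b d d≢0) , shape
      where
      at-0 : ∀ s t w → s * 0# + t * 0# + w ≡ w
      at-0 = solve 3 (λ s t w → s :* con 0 :+ t :* con 0 :+ w := w) refl
      at-1 : ∀ s t → s * 1# + t * 0# + 0# ≡ s
      at-1 = solve 2 (λ s t → s :* con 1 :+ t :* con 0 :+ con 0 := s) refl
      u≡0 : u ≡ 0#
      u≡0 = trans (sym (at-0 a b u)) (cong proj₁ (trans (sym (σ≡ 0# 0#)) σ0))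
      v≡0 : v ≡ 0#
      v≡0 = trans (sym (at-0 c d v)) (cong proj₂ (trans (sym (σ≡ 0# 0#)) σ0))
      a≡1 : a ≡ 1#
      a≡1 = trans (sym (at-1 a b)) (trans (cong (a * 1# + b * 0# +_) (sym u≡0))
                                          (cong proj₁ (trans (sym (σ≡ 1# 0#)) σ1)))
      c≡0 : c ≡ 0#
      c≡0 = trans (sym (at-1 c d)) (trans (cong (c * 1# + d * 0# +_) (sym v≡0))
                                          (cong proj₂ (trans (sym (σ≡ 1# 0#)) σ1)))
      shape : ∀ x y → to σ (x , y) ≡ (x + b * y , d * y)
      shape x y = begin
        to σ (x , y)                              ≡⟨ σ≡ x y ⟩
        a * x + b * y + u , c * x + d * y + v     ≡⟨ cong₂ _,_
          (cong₂ (λ i j → i * x + b * y + j) a≡1 u≡0) (cong₂ (λ i j → i * x + d * y + j) c≡0 v≡0) ⟩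
        1# * x + b * y + 0# , 0# * x + d * y + 0# ≡⟨ cong₂ _,_
          (solve 3 (λ b x y → con 1 :* x :+ b :* y :+ con 0 := x :+ b :* y) refl b x y)
          (solve 3 (λ d x y → con 0 :* x :+ d :* y :+ con 0 := d :* y) refl d x y) ⟩
        x + b * y , d * y                         ∎
      d≢0 : d ≢ 0#
      d≢0 d≡0 = det≢0 (begin
        a * d + - (b * c)  ≡⟨ cong₂ (λ i j → a * i + - (b * j)) d≡0 c≡0 ⟩
        a * 0# + - (b * 0#) ≡⟨ cong₂ (λ i j → i + - j) (zeroʳ a) (zeroʳ b) ⟩
        0# + - 0#          ≡⟨ -‿inverseʳ 0# ⟩
        0#                 ∎)

  -- The order of the frame stabilizer in the affine group.

  nonzero : ∃ (Enumeration (_≢ 0#))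
  nonzero = enumerate λ x → ¬? (x ≟ 0#)

  1+nonzero : q ≡ suc (proj₁ nonzero)
  1+nonzero = size-unique {Q = λ _ → ⊤} (full {P = λ _ → ⊤} _)
    (disjointUnion {P = _≡ 0#} zeros (proj₂ nonzero) (λ eq ≢ → ≢ eq) _ _ split) _ _
    where
    zeros : Enumeration (_≡ 0#) 1
    zeros = record
      { elem = λ _ → 0# ; elem-∈ = λ _ → refl ; elem-injective = λ { {zero} {zero} _ → refl }
      ; index = λ _ → zero ; elem-index = sym }
    split : ∀ {x} → ⊤ → x ≡ 0# ⊎ x ≢ 0#
    split {x} _ with x ≟ 0#
    ... | yes eq = inj₁ eq
    ... | no  ≢  = inj₂ ≢

  plane : Enumeration {V} (λ _ → ⊤) (q ℕ.* q)
  plane = image (product (full {P = λ _ → ⊤} _) (full {P = λ _ → ⊤} _)) id id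
                _ _ (λ _ → refl) (λ _ → refl)

  open SymmetricGroup plane

  -1≢0 : - 1# ≢ 0#
  -1≢0 eq = 0≢1 (sym (trans (sym (-‿involutive 1#)) (trans (cong -_ eq) -0#≈0#)))

  -- The element `r`, with matrix diag(1 , -1).
  reflection : Perm V
  reflection = shear 0# (- 1#) -1≢0

  frameStabilizer : Enumeration (λ x → IsAGL2 F (perm x) × FixesFrame (perm x)) (q ℕ.* proj₁ nonzero)
  frameStabilizer = image (product (full {P = λ _ → ⊤} _) (proj₂ nonzero))
    f (λ x → to (perm x) e₂)
    (λ { {b , d} (_ , d≢0) → f-∈ b d≢0 })
    (λ { {x} (h , fix) → g-∈ x h fix })
    (λ { {b , d} (_ , d≢0) → gf b d≢0 })
    (λ { {x} (h , fix) → fg x h fix })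
    where
    f : V → Fin order
    f (b , d) with d ≟ 0#
    -- A default for `d ≡ 0#`, which is outside the enumerated pairs.
    ... | yes _   = unit
    ... | no  d≢0 = code (shear b d d≢0)
    f≡ : ∀ b {d} → d ≢ 0# → ∃ λ d≢0 → f (b , d) ≡ code (shear b d d≢0)
    f≡ b {d} d≢0 with d ≟ 0#
    ... | yes eq  = ⊥-elim (d≢0 eq)
    ... | no  d≢0 = d≢0 , refl
    f-∈ : ∀ b {d} → d ≢ 0# → IsAGL2 F (perm (f (b , d))) × FixesFrame (perm (f (b , d)))
    f-∈ b {d} d≢0 with d≢0 , eq ← f≡ b d≢0 =
      subst (λ x → IsAGL2 F (perm x) × FixesFrame (perm x)) (sym eq)
        ( encode isPermSubgroup (shear b d d≢0) (shear-AGL₂ b d d≢0)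
        , encode fixesFrame-isPermSubgroup (shear b d d≢0) (shear-fixesFrame b d d≢0))
    gf : ∀ b {d} → d ≢ 0# → to (perm (f (b , d))) e₂ ≡ (b , d)
    gf b {d} d≢0 with d≢0 , eq ← f≡ b d≢0 = trans (cong (λ x → to (perm x) e₂) eq)
      (trans (perm-code (shear b d d≢0) e₂) (shear-e₂ b d d≢0))
    g-∈ : ∀ x → IsAGL2 F (perm x) → FixesFrame (perm x) → ⊤ × proj₂ (to (perm x) e₂) ≢ 0#
    g-∈ x h fix with _ , _ , d≢0 , eq , _ ← fixesFrame⇒shear (perm x) h fix =
      tt , λ ≡0 → d≢0 (trans (sym (cong proj₂ eq)) ≡0)
    fg : ∀ x → IsAGL2 F (perm x) → FixesFrame (perm x) → f (to (perm x) e₂) ≡ x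
    fg x h fix with b , d , d≢0 , eq , shape ← fixesFrame⇒shear (perm x) h fix
      with d≢0 , eq′ ← f≡ b d≢0 =
      trans (cong f eq) (trans eq′ (trans
        (code-cong (shear b d d≢0) (perm x) λ (x , y) → sym (shape x y)) (code-perm x)))

  -- The case of `q` congruent to 3 modulo 4.

  module _ (q≡3 : q % 4 ≡ 3) where

    private
      q≡ : q ≡ 3 ℕ.+ q / 4 ℕ.* 4
      q≡ = trans (m≡m%n+[m/n]*n q 4) (cong (ℕ._+ q / 4 ℕ.* 4) q≡3)

    odd : ¬ 2 ∣ q
    odd 2∣q = from-no (2 ∣? 3) (∣m+n∣m⇒∣n (subst (2 ∣_) (trans q≡ (ℕ.+-comm 3 _)) 2∣q)
                                          (∣n⇒∣m*n (q / 4) (divides 2 refl)))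

    -- `q` is odd and the second factor `q - 1` is 2 modulo 4.
    4∤ : ¬ 4 ∣ q ℕ.* proj₁ nonzero
    4∤ 4∣ = from-no (4 ∣? 2) (∣m+n∣m⇒∣n
      (subst (4 ∣_) (trans (ℕ.suc-injective (trans (sym 1+nonzero) q≡)) (ℕ.+-comm 2 _)) (odd-4∣ _ odd 4∣))
      (divides (q / 4) refl))

    -- In characteristic two, adding `1#` would be a free involution on a field of odd order.
    1+1≢0 : 1# + 1# ≢ 0#
    1+1≢0 1+1≡0 = odd (free-involution⇒2∣ (full {P = λ _ → ⊤} _) (1# +_) _
      (λ {x} _ → trans (sym (+-assoc 1# 1# x)) (trans (cong (_+ x) 1+1≡0) (+-identityˡ x)))
      (λ {x} _ eq → 0≢1 (sym (+-cancelʳ x 1# 0# (trans eq (sym (+-identityˡ x)))))))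

    y≡-y⇒y≡0 : ∀ y → y ≡ - y → y ≡ 0#
    y≡-y⇒y≡0 y eq with y ≟ 0#
    ... | yes y≡0 = y≡0
    ... | no  y≢0 = ⊥-elim (1+1≢0 (begin
      1# + 1#                  ≡⟨ cong (λ i → i + i) (proj₂ (inverse y y≢0)) ⟨
      y * δ + y * δ            ≡⟨ cong (λ i → y * δ + i * δ) eq ⟩
      y * δ + - y * δ          ≡⟨ cong (y * δ +_) (-‿distribˡ-* y δ) ⟨
      y * δ + - (y * δ)        ≡⟨ -‿inverseʳ _ ⟩
      0#                       ∎))
      where
      δ : K
      δ = proj₁ (inverse y y≢0)

    reflection≡ : ∀ x y → to reflection (x , y) ≡ (x , - y)
    reflection≡ x y = cong₂ _,_ (trans (cong (x +_) (zeroˡ y)) (+-identityʳ x)) (-1*x≈-x y)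

    reflection-fixed : ∀ v → to reflection v ≡ v → proj₂ v ≡ 0#
    reflection-fixed (x , y) eq = y≡-y⇒y≡0 y (sym (cong proj₂ (trans (sym (reflection≡ x y)) eq)))

    fixed-by-reflection : ∀ v → proj₂ v ≡ 0# → to reflection v ≡ v
    fixed-by-reflection (x , _) refl = trans (reflection≡ x 0#) (cong (x ,_) -0#≈0#)

    reflection² : ∀ v → to reflection (to reflection v) ≡ v
    reflection² (x , y) = trans (cong (to reflection) (reflection≡ x y))
      (trans (reflection≡ x (- y)) (cong (x ,_) (-‿involutive y)))

    reflection-self-inverse : (reflection ⁻¹ₚ) ≈ₚ reflection
    reflection-self-inverse v = trans (cong (from reflection) (sym (reflection² v)))
                                      (from∘to reflection (to reflection v))

    reflection≉id : ¬ (reflection ≈ₚ idₚ)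
    reflection≉id eq = 0≢1 (sym (reflection-fixed e₂ (eq e₂)))

    -- A square root commutes with the reflection and so preserves the set of points it moves, those
    -- with nonzero second coordinate. On these it generates a free cyclic action of order four, but
    -- their number `q * (q - 1)` is the one excluded by `4∤`.
    reflection-nonsquare : ∀ σ → ¬ ((σ · σ) ≈ₚ reflection)
    reflection-nonsquare σ σσ≈ρ = 4∤ (free-square⇒4∣ (product (full {P = λ _ → ⊤} _) (proj₂ nonzero))
      ρ (to σ) (λ { {v} (_ , ≢) → tt , λ eq → ≢ (ρ-off v eq) })
      (λ { {v} (_ , ≢) → tt , λ eq → ≢ (σ-off v eq) })
      (λ {v} _ → reflection² v) (λ { {v} (_ , ≢) eq → ≢ (reflection-fixed v eq) })
      (λ {v} _ → commute v) (λ {v} _ → inj₂ (σσ≈ρ v))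
      (λ { {v} (_ , ≢) eq → ≢ (reflection-fixed v (trans (sym (σσ≈ρ v)) (trans (cong (to σ) eq) eq))) })
      -- From `σ v = ρ v = σ (σ v)` injectivity gives `v = σ v`, hence `ρ v = v`.
      (λ { {v} (_ , ≢) eq → ≢ (reflection-fixed v
        (trans (sym eq) (sym (to-injective σ (trans eq (sym (σσ≈ρ v))))))) }))
      where
      ρ : V → V
      ρ = to reflection
      commute : ∀ v → ρ (to σ v) ≡ to σ (ρ v)
      commute v = trans (sym (σσ≈ρ (to σ v))) (cong (to σ) (σσ≈ρ v))
      ρ-off : ∀ v → proj₂ (ρ v) ≡ 0# → proj₂ v ≡ 0#
      ρ-off v eq = reflection-fixed v (trans (sym (fixed-by-reflection (ρ v) eq)) (reflection² v))
      σ-off : ∀ v → proj₂ (to σ v) ≡ 0# → proj₂ v ≡ 0#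
      σ-off v eq = reflection-fixed v (to-injective σ
        (trans (sym (commute v)) (fixed-by-reflection (to σ v) eq)))

    AGL₂-isPerfectCode : IsPerfectCodeOfGroup (IsAGL2 F)
    AGL₂-isPerfectCode = isPerfectCode {H = IsAGL2 F} {FixesFrame}
      (isAGL₂? ∘ perm) (fixesFrame? ∘ perm)
      isPermSubgroup fixesFrame-isPermSubgroup factorise frameStabilizer 4∤
      {ρ = reflection} (shear-AGL₂ 0# (- 1#) -1≢0) (shear-fixesFrame 0# (- 1#) -1≢0)
      reflection-self-inverse reflection≉id reflection-nonsquare
      where
      factorise : ∀ σ → ∃ λ τ → FixesFrame τ × IsAGL2 F (τ · (σ ⁻¹ₚ))
      factorise σ = through (two-transitive (to σ origin) (to σ e₁)
        (λ eq → 0≢1 (cong proj₁ (to-injective σ {origin} {e₁} eq))))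
        where
        through : (∃ λ h → IsAGL2 F h × to h (to σ origin) ≡ origin × to h (to σ e₁) ≡ e₁) →
                  ∃ λ τ → FixesFrame τ × IsAGL2 F (τ · (σ ⁻¹ₚ))
        -- `h` moves the images of the two frame points under `σ` back, so `h · σ` fixes the frame,
        -- while `(h · σ) · (σ ⁻¹ₚ)` is `h`.
        through (h , h∈ , h0 , h1) = h · σ , (h0 , h1) ,
          IsPermSubgroup.respects isPermSubgroup {h} {(h · σ) · (σ ⁻¹ₚ)}
            (λ v → cong (to h) (sym (to∘from σ v))) h∈

theorem1p7 : (q : ℕ) → IsPrimePower q → q % 4 ≡ 3 → (F : FiniteField q) →
    IsPerfectCodeOfGroup {Vec2 F} (IsAGL2 F)
theorem1p7 q _ q≡3 F = AffinePlane.AGL₂-isPerfectCode F q≡3
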